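{- Let $k\ge 1$ be an integer and let $p$ be a pattern with exactly $k$ distinct variables. (a) If $p$ has length at least $2^k$, then $\lambda(p)\le 3$. (b) If $p$ has length at least $3\times 2^{k-1}$, then $\lambda(p)=2$.
   Context: A pattern is a non-empty finite word over an alphabet $\Delta$ of symbols called variables. A word $x$ over an alphabet $\Sigma$ is an instance of a pattern $p$ if there is a non-erasing morphism $h:\Delta^*\to\Sigma^*$ (i.e. $h(X)$ is a non-empty word for every variable $X$) with $h(p)=x$. An infinite word $w$ over $\Sigma$ avoids $p$ if no factor (contiguous block) of $w$ is an instance of $p$. The avoidability index $\lambda(p)$ is the size of the smallest finite alphabet $\Sigma$ such that some infinite word over $\Sigma$ avoids $p$ ($\lambda(p)=\infty$ if no such finite alphabet exists). The length of $p$ is its number of letters (counted with multiplicity). -}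

module Defs where

open import Data.Nat using (ℕ; _+_; _≤_; _<_)
open import Data.Fin using (Fin)
open import Data.List using (List; []; _∷_; length; concatMap; applyUpTo)
open import Data.List.Membership.Propositional using (_∈_)
open import Data.Product using (Σ; ∃; _×_)
open import Relation.Nullary using (¬_)
open import Relation.Binary.PropositionalEquality using (_≡_)

-- A pattern over the variable alphabet Fin k: a non-empty finite word.
-- "p has exactly k distinct variables" is encoded by taking Δ = Fin k
-- and requiring every variable of Fin k to occur in p.
NonEmpty : {A : Set} → List A → Set
NonEmpty xs = ¬ (xs ≡ [])

UsesAllVars : {k : ℕ} → List (Fin k) → Set
UsesAllVars {k} p = (X : Fin k) → X ∈ p

InfWord : ℕ → Set
InfWord n = ℕ → Fin n

FactorAt : {n : ℕ} → InfWord n → ℕ → List (Fin n) → Set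
FactorAt w i u = u ≡ applyUpTo (λ j → w (i + j)) (length u)

Factor : {n : ℕ} → InfWord n → List (Fin n) → Set
Factor w u = ∃ λ i → FactorAt w i u

-- Non-erasing morphisms Δ* → Σ*, determined by images of variables.
NonErasing : {k n : ℕ} → (Fin k → List (Fin n)) → Set
NonErasing {k} h = (X : Fin k) → NonEmpty (h X)

InstanceOf : {k n : ℕ} → List (Fin n) → List (Fin k) → Set
InstanceOf {k} {n} x p =
  Σ (Fin k → List (Fin n)) λ h → NonErasing h × (concatMap h p ≡ x)

Avoids : {k n : ℕ} → InfWord n → List (Fin k) → Set
Avoids {k} {n} w p = (u : List (Fin n)) → Factor w u → ¬ InstanceOf u p

AvoidableOver : {k : ℕ} → ℕ → List (Fin k) → Set
AvoidableOver n p = Σ (InfWord n) λ w → Avoids w p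

AvoidIndexLE : {k : ℕ} → List (Fin k) → ℕ → Set
AvoidIndexLE p m = ∃ λ n → n ≤ m × AvoidableOver n p

AvoidIndexEq : {k : ℕ} → List (Fin k) → ℕ → Set
AvoidIndexEq p m = AvoidableOver m p × ((n : ℕ) → n < m → ¬ AvoidableOver n p)

{-# OPTIONS --safe #-}

-- If a variable occurs at most once, deleting it leaves a factor with one variable fewer and at least
-- half the length, so by induction on k every variable may be assumed to occur at least twice.
--
-- For k ≥ 3 the number of instances is small enough for Miller's greedy argument.  Read the word from
-- left to right, give a started instance with r letters still to come the weight c^r, and choose each
-- letter so that the total weight of the started instances stays below 1.  Averaging over the m letters
-- this is possible when 1 + S ≤ c m, where S is the sum of c^|x| over all instances x; multiplicities
-- at least 2 give S ≤ c^(|p| - 2k) (m c² / (1 - m c²))^k.  To keep the construction computable, an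
-- instance is tracked only after a small fraction of it has been read, so that at each time finitely
-- many instances matter; the constant q > 1 pays for this.
--
-- For k ≤ 2 there are explicit words: the Thue–Morse word is overlap-free, its difference sequence is a
-- square-free ternary word, and the image of a square-free ternary word under a suitable 12-uniform
-- morphism has no squares of period at least 3 and avoids all binary patterns of length 6 that contain
-- no overlap.
module Submission where

open import Defs
open import Algebra.Bundles using (CommutativeRing)
open import Data.Bool using (Bool; true; false; not; _xor_; if_then_else_)
open import Data.Bool.Properties using (not-injective; not-¬; ¬-not)
import Data.Bool.Properties as Bool
open import Data.Empty using (⊥)
open import Data.Fin using (Fin; zero; suc; _≟_; punchIn; punchOut)
open import Data.Fin.Properties using (any?; all?; punchIn-punchOut)
import Data.Integer as ℤ
open import Data.List using (List; []; _∷_; _++_; map; length; concatMap; applyUpTo; drop; allFin; cartesianProductWith)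
open import Data.List.Membership.Propositional using (_∈_)
open import Data.List.Membership.Propositional.Properties using (∈-++⁺ˡ; ∈-++⁺ʳ; ∈-map⁺; ∈-allFin; ∈-cartesianProductWith⁺; ∈-cartesianProductWith⁻)
open import Data.List.Properties using (concatMap-++; concatMap-cong; concatMap-map; length-++; length-drop; length-map; length-applyUpTo; map-tabulate; map-∘; map-id; map-cong)
open import Data.List.Relation.Unary.All using (All)
import Data.List.Relation.Unary.All as All
open import Data.List.Relation.Unary.Any using (here; there)
open import Data.Nat using (ℕ; zero; suc; _+_; _*_; _∸_; _^_; _/_; _%_; _≤_; _<_; z≤n; s≤s; s≤s⁻¹; z<s; ⌊_/2⌋; NonZero)
open import Data.Nat.DivMod using (m≡m%n+[m/n]*n; m%n<n; m/n*n≤m; +-distrib-/-∣ˡ; %-remove-+ˡ; m*n/n≡m; m<n⇒m/n≡0; m<n⇒m%n≡m)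
open import Data.Nat.Divisibility using (n∣m*n)
open import Data.Nat.Induction using (<-rec)
import Data.Nat.ListAction as List
open import Data.Nat.Properties hiding (_≟_)
open import Data.Nat.Tactic.RingSolver using (solve-∀)
open import Data.Product using (Σ; ∃; ∃₂; _×_; _,_; proj₁; proj₂; uncurry)
open import Data.Rational as ℚ using (ℚ; 0ℚ; 1ℚ)
import Data.Rational.Properties as ℚₚ
open import Data.Sum using (_⊎_; inj₁; inj₂; [_,_]′)
open import Data.Unit using (tt)
open import Data.Vec using (Vec; []; _∷_; lookup)
import Data.Vec as Vec
open import Data.Vec.Properties using (lookup∘tabulate)
open import Function using (_∘_; id)
open import Relation.Binary.PropositionalEquality using (_≡_; _≢_; refl; sym; trans; cong; cong₂; subst; module ≡-Reasoning)
open import Relation.Nullary using (¬_; Dec; yes; no; contradiction; does; ¬?)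
open import Relation.Nullary.Decidable using (toWitness; map′; _×-dec_; _→-dec_; _⊎-dec_)
open import Algebra.Properties.CommutativeMonoid.Sum +-0-commutativeMonoid using (sum; ∑-distrib-+; sum-cong-≗; sum-replicate-zero)
open import Algebra.Properties.CommutativeSemigroup (CommutativeRing.+-commutativeSemigroup ℚₚ.+-*-commutativeRing) using () renaming (interchange to +-interchange)
open import Algebra.Properties.CommutativeSemigroup (CommutativeRing.*-commutativeSemigroup ℚₚ.+-*-commutativeRing) using () renaming (interchange to *-interchange)
open import Algebra.Properties.CommutativeSemiring.Exp (CommutativeRing.commutativeSemiring ℚₚ.+-*-commutativeRing) using () renaming (_^_ to _^^_; ^-homo-* to ^^-homo-*; ^-assocʳ to ^^-assocʳ; ^-distrib-* to ^^-distrib-*)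

-- Occurrences of finite words in infinite words

-- Replaces the equation with `applyUpTo` in `FactorAt` by recursion on the word, so that parts of
-- an occurrence are reached by pattern matching.
data Occurs {A : Set} (w : ℕ → A) (i : ℕ) : List A → Set where
  []  : Occurs w i []
  _∷_ : ∀ {x u} → x ≡ w i → Occurs w (suc i) u → Occurs w i (x ∷ u)

module _ {A : Set} {w : ℕ → A} where

  occurs-applyUpTo : ∀ n {i} (f : ℕ → A) → (∀ j → f j ≡ w (i + j)) → Occurs w i (applyUpTo f n)
  occurs-applyUpTo zero        f f≡ = []
  occurs-applyUpTo (suc n) {i} f f≡ =
    trans (f≡ 0) (cong w (+-identityʳ i)) ∷
    occurs-applyUpTo n (f ∘ suc) λ j → trans (f≡ (suc j)) (cong w (+-suc i j))

  occurs-++⁻ˡ : ∀ {i} u {v} → Occurs w i (u ++ v) → Occurs w i u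
  occurs-++⁻ˡ []      o       = []
  occurs-++⁻ˡ (x ∷ u) (e ∷ o) = e ∷ occurs-++⁻ˡ u o

  occurs-++⁻ʳ : ∀ {i} u {v} → Occurs w i (u ++ v) → Occurs w (i + length u) v
  occurs-++⁻ʳ {i} []      {v} o       = subst (λ n → Occurs w n v) (sym (+-identityʳ i)) o
  occurs-++⁻ʳ {i} (x ∷ u) {v} (e ∷ o) = subst (λ n → Occurs w n v) (sym (+-suc i (length u))) (occurs-++⁻ʳ u o)

  occurs-drop : ∀ {i} n {u} → Occurs w i u → Occurs w (i + n) (drop n u)
  occurs-drop {i} zero    {u}     o       = subst (λ m → Occurs w m u) (sym (+-identityʳ i)) o
  occurs-drop     (suc n)         []      = []
  occurs-drop {i} (suc n) {x ∷ u} (e ∷ o) =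
    subst (λ m → Occurs w m (drop n u)) (sym (+-suc i n)) (occurs-drop n o)

  occurs-agree : ∀ {i i′ u} → Occurs w i u → Occurs w i′ u →
                 ∀ j → j < length u → w (i + j) ≡ w (i′ + j)
  occurs-agree {i} {i′} (e ∷ o) (e′ ∷ o′) zero    _ =
    trans (cong w (+-identityʳ i)) (trans (trans (sym e) e′) (cong w (sym (+-identityʳ i′))))
  occurs-agree {i} {i′} (e ∷ o) (e′ ∷ o′) (suc j) (s≤s j<) =
    trans (cong w (+-suc i j)) (trans (occurs-agree o o′ j j<) (cong w (sym (+-suc i′ j))))

Square : {A : Set} → (ℕ → A) → ℕ → ℕ → Set
Square w m i = ∀ j → j < m → w (i + j) ≡ w (i + m + j)

SquareFree : {A : Set} → (ℕ → A) → Set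
SquareFree w = ∀ m i → 0 < m → ¬ Square w m i

occurs-square : ∀ {A : Set} {w : ℕ → A} {i} u {v} → Occurs w i (u ++ u ++ v) → Square w (length u) i
occurs-square u o = occurs-agree (occurs-++⁻ˡ u o) (occurs-++⁻ˡ u (occurs-++⁻ʳ u o))

Avoiding : ∀ {k n} → InfWord n → List (Fin k) → Set
Avoiding w p = ∀ i h → NonErasing h → ¬ Occurs w i (concatMap h p)

avoiding⇒avoids : ∀ {k n} {w : InfWord n} (p : List (Fin k)) → Avoiding w p → Avoids w p
avoiding⇒avoids {w = w} p av u (i , u≡) (h , ne , hp≡u) =
  av i h ne (subst (Occurs w i) (sym (trans hp≡u u≡)) (occurs-applyUpTo (length u) _ λ _ → refl))

module _ {k n} {w : InfWord n} (h : Fin k → List (Fin n)) where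

  occurs-image-++⁻ˡ : ∀ {i} p {q} → Occurs w i (concatMap h (p ++ q)) → Occurs w i (concatMap h p)
  occurs-image-++⁻ˡ {i} p {q} o =
    occurs-++⁻ˡ (concatMap h p) (subst (Occurs w i) (concatMap-++ h p q) o)

  occurs-image-++⁻ʳ : ∀ {i} p {q} → Occurs w i (concatMap h (p ++ q)) →
                      Occurs w (i + length (concatMap h p)) (concatMap h q)
  occurs-image-++⁻ʳ {i} p {q} o =
    occurs-++⁻ʳ (concatMap h p) (subst (Occurs w i) (concatMap-++ h p q) o)

  image-square : ∀ {i} a p {b} → Occurs w i (concatMap h (a ++ p ++ p ++ b)) →
                 ∃ λ i′ → Square w (length (concatMap h p)) i′
  image-square a p {b} o = _ , occurs-square (concatMap h p) {concatMap h b}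
    (subst (Occurs w _)
      (trans (concatMap-++ h p (p ++ b)) (cong (concatMap h p ++_) (concatMap-++ h p b)))
      (occurs-image-++⁻ʳ a o))

avoiding-factor : ∀ {k n} {w : InfWord n} (a p : List (Fin k)) {b} →
                  Avoiding w p → Avoiding w (a ++ p ++ b)
avoiding-factor a p av i h ne o =
  av _ h ne (occurs-image-++⁻ˡ h p (occurs-image-++⁻ʳ h a o))

nonEmpty⇒0<length : ∀ {A : Set} (u : List A) → NonEmpty u → 0 < length u
nonEmpty⇒0<length []      ne = contradiction refl ne
nonEmpty⇒0<length (_ ∷ _) _  = z<s

-- The Thue–Morse word

odd : ℕ → Bool
odd zero    = false
odd (suc n) = not (odd n)

-- The parity of the binary digit sum; the first argument is fuel, and n suffices for n.
digitParity : ℕ → ℕ → Bool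
digitParity zero    n = false
digitParity (suc f) n = odd n xor digitParity f ⌊ n /2⌋

thueMorse : ℕ → Bool
thueMorse n = digitParity n n

digitParity-zero : ∀ f → digitParity f 0 ≡ false
digitParity-zero zero    = refl
digitParity-zero (suc f) = digitParity-zero f

digitParity-fuel : ∀ f g n → n ≤ f → n ≤ g → digitParity f n ≡ digitParity g n
digitParity-fuel zero    g       .0 z≤n _ = sym (digitParity-zero g)
digitParity-fuel (suc f) zero    .0 _ z≤n = digitParity-zero f
digitParity-fuel (suc f) (suc g) n n≤f n≤g =
  cong (odd n xor_) (digitParity-fuel f g ⌊ n /2⌋ (half≤ n n≤f) (half≤ n n≤g))
  where
  half≤ : ∀ n {f} → n ≤ suc f → ⌊ n /2⌋ ≤ f
  half≤ zero    _    = z≤n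
  half≤ (suc n) n<f = s≤s⁻¹ (≤-trans (⌊n/2⌋<n n) n<f)

odd-double : ∀ n → odd (n + n) ≡ false
odd-double zero    = refl
odd-double (suc n) rewrite +-suc n n | odd-double n = refl

thueMorse-even : ∀ n → thueMorse (n + n) ≡ thueMorse n
thueMorse-even n = begin
  digitParity (n + n) (n + n)                             ≡⟨ digitParity-fuel (n + n) (suc (n + n)) (n + n) ≤-refl (n≤1+n _) ⟩
  odd (n + n) xor digitParity (n + n) ⌊ n + n /2⌋         ≡⟨ cong₂ (λ b m → b xor digitParity (n + n) m) (odd-double n) (sym (n≡⌊n+n/2⌋ n)) ⟩
  digitParity (n + n) n                                   ≡⟨ digitParity-fuel (n + n) n n (m≤m+n n n) ≤-refl ⟩
  thueMorse n                                             ∎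
  where open ≡-Reasoning

thueMorse-odd : ∀ n → thueMorse (suc (n + n)) ≡ not (thueMorse n)
thueMorse-odd n = begin
  not (odd (n + n)) xor digitParity (n + n) ⌊ suc (n + n) /2⌋ ≡⟨ cong₂ (λ b m → not b xor digitParity (n + n) m) (odd-double n) (sym (n≡⌈n+n/2⌉ n)) ⟩
  not (digitParity (n + n) n)                                 ≡⟨ cong not (digitParity-fuel (n + n) n n (m≤m+n n n) ≤-refl) ⟩
  not (thueMorse n)                                           ∎
  where open ≡-Reasoning

data Half : ℕ → Set where
  twice    : ∀ n → Half (n + n)
  suctwice : ∀ n → Half (suc (n + n))

half : ∀ n → Half n
half zero    = twice 0
half (suc n) with half n
... | twice    m = suctwice m
... | suctwice m = subst Half (cong suc (+-suc m m)) (twice (suc m))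

-- The bound `j ≤ m`, against `j < m` in `Square`, prolongs a square by one letter.
Overlap : {A : Set} → (ℕ → A) → ℕ → ℕ → Set
Overlap w m i = ∀ j → j ≤ m → w (i + j) ≡ w (i + m + j)

-- An overlap of even period 2n restricts, on the positions of one parity, to an overlap of period n.
-- An odd period m pairs positions of opposite parity, and one of each pair starts a block 01 or 10;
-- so the word alternates along the overlap, against t(i) = t(i + m).
thueMorse-overlapFree : ∀ m i → 0 < m → ¬ Overlap thueMorse m i
thueMorse-overlapFree = <-rec _ λ m rec i 0<m ov → byParity (half m) rec i 0<m ov
  where
  t = thueMorse
  open ≡-Reasoning

  Goal : ℕ → Set
  Goal m = ∀ i → 0 < m → ¬ Overlap t m i

  halve : ∀ n → 0 < n + n → n < n + n
  halve (suc n) _ = m<m+n (suc n) z<s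

  pos : ∀ n → 0 < n + n → 0 < n
  pos (suc n) _ = z<s

  even+even : ∀ a j → (a + a) + (j + j) ≡ (a + j) + (a + j)
  even+even = solve-∀

  even+even+even : ∀ a n j → (a + a) + (n + n) + (j + j) ≡ (a + n + j) + (a + n + j)
  even+even+even = solve-∀

  alternating : ∀ m i → (∀ j → j < m → t (i + suc j) ≡ not (t (i + j))) →
                ∀ j → j ≤ m → t (i + j) ≡ odd j xor t i
  alternating m i step zero    _   = cong t (+-identityʳ i)
  alternating m i step (suc j) j<m = begin
    t (i + suc j)          ≡⟨ step j j<m ⟩
    not (t (i + j))        ≡⟨ cong not (alternating m i step j (<⇒≤ j<m)) ⟩
    not (odd j xor t i)    ≡⟨ Bool.not-distribˡ-xor (odd j) (t i) ⟩
    not (odd j) xor t i    ∎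

  block : ∀ a → t (suc (a + a)) ≡ not (t (a + a))
  block a = trans (thueMorse-odd a) (cong not (sym (thueMorse-even a)))

  even-position : ∀ a → odd a ≡ false → t (suc a) ≡ not (t a)
  even-position a e with half a
  ... | twice    b = block b
  ... | suctwice b rewrite odd-double b = contradiction e λ ()

  odd-+ : ∀ a b → odd (a + b) ≡ odd a xor odd b
  odd-+ zero    b = refl
  odd-+ (suc a) b = trans (cong not (odd-+ a b)) (Bool.not-distribˡ-xor (odd a) (odd b))

  byParity : ∀ {m} → Half m → (∀ {n} → n < m → Goal n) → Goal m
  byParity (twice n) rec i 0<m ov with half i
  ... | twice a = rec (halve n 0<m) a (pos n 0<m) λ j j≤n → begin
    t (a + j)                         ≡⟨ thueMorse-even (a + j) ⟨
    t ((a + j) + (a + j))             ≡⟨ cong t (even+even a j) ⟨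
    t ((a + a) + (j + j))             ≡⟨ ov (j + j) (+-mono-≤ j≤n j≤n) ⟩
    t ((a + a) + (n + n) + (j + j))   ≡⟨ cong t (even+even+even a n j) ⟩
    t ((a + n + j) + (a + n + j))     ≡⟨ thueMorse-even (a + n + j) ⟩
    t (a + n + j)                     ∎
  ... | suctwice a = rec (halve n 0<m) a (pos n 0<m) λ j j≤n → not-injective (begin
    not (t (a + j))                       ≡⟨ thueMorse-odd (a + j) ⟨
    t (suc ((a + j) + (a + j)))           ≡⟨ cong (t ∘ suc) (even+even a j) ⟨
    t (suc (a + a) + (j + j))             ≡⟨ ov (j + j) (+-mono-≤ j≤n j≤n) ⟩
    t (suc (a + a) + (n + n) + (j + j))   ≡⟨ cong (t ∘ suc) (even+even+even a n j) ⟩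
    t (suc ((a + n + j) + (a + n + j)))   ≡⟨ thueMorse-odd (a + n + j) ⟩
    not (t (a + n + j))                   ∎)
  byParity (suctwice n) rec i 0<m ov = not-¬ refl (begin
    t i                 ≡⟨ cong t (+-identityʳ i) ⟨
    t (i + 0)           ≡⟨ ov 0 z≤n ⟩
    t (i + m + 0)       ≡⟨ cong t (+-identityʳ (i + m)) ⟩
    t (i + m)           ≡⟨ alternating m i step m ≤-refl ⟩
    odd m xor t i       ≡⟨ cong (λ b → not b xor t i) (odd-double n) ⟩
    not (t i)           ∎)
    where
    m = suc (n + n)

    step : ∀ j → j < m → t (i + suc j) ≡ not (t (i + j))
    step j j<m with odd (i + j) in parity
    ... | false = trans (cong t (+-suc i j)) (even-position (i + j) parity)
    ... | true  = begin
      t (i + suc j)          ≡⟨ ov (suc j) j<m ⟩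
      t (i + m + suc j)      ≡⟨ cong t (+-suc (i + m) j) ⟩
      t (suc (i + m + j))    ≡⟨ even-position (i + m + j) shifted ⟩
      not (t (i + m + j))    ≡⟨ cong not (ov j (<⇒≤ j<m)) ⟨
      not (t (i + j))        ∎
      where
      rearrange : ∀ i n j → i + suc (n + n) + j ≡ suc (n + n + (i + j))
      rearrange = solve-∀

      shifted : odd (i + m + j) ≡ false
      shifted = begin
        odd (i + m + j)                      ≡⟨ cong odd (rearrange i n j) ⟩
        not (odd (n + n + (i + j)))          ≡⟨ cong not (odd-+ (n + n) (i + j)) ⟩
        not (odd (n + n) xor odd (i + j))    ≡⟨ cong₂ (λ a b → not (a xor b)) (odd-double n) parity ⟩
        false                                ∎

-- A square-free ternary word

-- Second bit minus first bit, with the values -1, 0, 1 coded as 0, 1, 2.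
difference : Bool → Bool → Fin 3
difference false true  = suc (suc zero)
difference true  false = zero
difference false false = suc zero
difference true  true  = suc zero

difference-injectiveʳ : ∀ a {b b′} → difference a b ≡ difference a b′ → b ≡ b′
difference-injectiveʳ false {false} {false} _ = refl
difference-injectiveʳ false {true}  {true}  _ = refl
difference-injectiveʳ true  {false} {false} _ = refl
difference-injectiveʳ true  {true}  {true}  _ = refl

-- Before coding, differences from `false` are 0 or 1 and those from `true` are -1 or 0, so the two
-- agree only when both vanish.
difference-not : ∀ a {b b′} → difference a b ≡ difference (not a) b′ → b ≡ a × b′ ≡ not a
difference-not false {false} {true}  _ = refl , refl
difference-not false {false} {false} ()
difference-not false {true}  {false} ()
difference-not true  {true}  {false} _ = refl , refl
difference-not true  {true}  {true}  ()
difference-not true  {false} {true}  ()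

ternary : ℕ → Fin 3
ternary n = difference (thueMorse n) (thueMorse (suc n))

-- If t(i) = t(i + m), equal differences propagate this to an overlap of t; otherwise
-- the differences must all vanish, so t is constant on [i, i + m], again a contradiction.
ternary-squareFree : SquareFree ternary
ternary-squareFree m i 0<m sq with thueMorse i Bool.≟ thueMorse (i + m)
... | yes e = thueMorse-overlapFree m i 0<m overlaps
  where
  t = thueMorse
  overlaps : Overlap t m i
  overlaps zero    _   = trans (cong t (+-identityʳ i)) (trans e (cong t (sym (+-identityʳ (i + m)))))
  overlaps (suc j) j<m rewrite +-suc i j | +-suc (i + m) j =
    difference-injectiveʳ (t (i + j)) (trans (sq j j<m)
      (cong (λ b → difference b (t (suc (i + m + j)))) (sym (overlaps j (<⇒≤ j<m)))))
... | no ne = ne (sym (proj₁ (constant m ≤-refl)))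
  where
  t = thueMorse
  constant : ∀ j → j ≤ m → t (i + j) ≡ t i × t (i + m + j) ≡ not (t i)
  constant zero    _   = cong t (+-identityʳ i) ,
                         trans (cong t (+-identityʳ (i + m))) (¬-not (ne ∘ sym))
  constant (suc j) j<m rewrite +-suc i j | +-suc (i + m) j =
    let (e , e′) = constant j (<⇒≤ j<m) in
    difference-not (t i) (trans (cong (λ b → difference b (t (suc (i + j)))) (sym e))
      (trans (sq j j<m) (cong (λ b → difference b (t (suc (i + m + j)))) e′)))

-- Powers and finite sums of rationals

*-monoˡ : ∀ {a b b′} → 0ℚ ℚ.≤ a → b ℚ.≤ b′ → a ℚ.* b ℚ.≤ a ℚ.* b′
*-monoˡ {a} 0≤a = ℚₚ.*-monoˡ-≤-nonNeg a {{ℚ.nonNegative 0≤a}}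

*-mono : ∀ {a a′ b b′} → 0ℚ ℚ.≤ a′ → 0ℚ ℚ.≤ b → a ℚ.≤ a′ → b ℚ.≤ b′ → a ℚ.* b ℚ.≤ a′ ℚ.* b′
*-mono {b = b} 0≤a′ 0≤b a≤a′ b≤b′ =
  ℚₚ.≤-trans (ℚₚ.*-monoʳ-≤-nonNeg b {{ℚ.nonNegative 0≤b}} a≤a′) (*-monoˡ 0≤a′ b≤b′)

*-nonNeg : ∀ {a b} → 0ℚ ℚ.≤ a → 0ℚ ℚ.≤ b → 0ℚ ℚ.≤ a ℚ.* b
*-nonNeg {a} 0≤a 0≤b = ℚₚ.≤-trans (ℚₚ.≤-reflexive (sym (ℚₚ.*-zeroʳ a))) (*-monoˡ 0≤a 0≤b)

^^-nonNeg : ∀ {a} n → 0ℚ ℚ.≤ a → 0ℚ ℚ.≤ a ^^ n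
^^-nonNeg zero    _   = ℚₚ.nonNegative⁻¹ 1ℚ
^^-nonNeg (suc n) 0≤a = *-nonNeg 0≤a (^^-nonNeg n 0≤a)

^^-monoˡ : ∀ {a b} n → 0ℚ ℚ.≤ a → a ℚ.≤ b → a ^^ n ℚ.≤ b ^^ n
^^-monoˡ zero    _   _   = ℚₚ.≤-refl
^^-monoˡ (suc n) 0≤a a≤b = *-mono (ℚₚ.≤-trans 0≤a a≤b) (^^-nonNeg n 0≤a) a≤b (^^-monoˡ n 0≤a a≤b)

1^^ : ∀ n → 1ℚ ^^ n ≡ 1ℚ
1^^ zero    = refl
1^^ (suc n) = trans (ℚₚ.*-identityˡ _) (1^^ n)

^^-antitone : ∀ {a m n} → 0ℚ ℚ.≤ a → a ℚ.≤ 1ℚ → m ≤ n → a ^^ n ℚ.≤ a ^^ m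
^^-antitone {n = n} 0≤a a≤1 z≤n       = ℚₚ.≤-trans (^^-monoˡ n 0≤a a≤1) (ℚₚ.≤-reflexive (1^^ n))
^^-antitone         0≤a a≤1 (s≤s m≤n) = *-monoˡ 0≤a (^^-antitone 0≤a a≤1 m≤n)

^^-≥1 : ∀ {a} n → 1ℚ ℚ.≤ a → 1ℚ ℚ.≤ a ^^ n
^^-≥1 n 1≤a = ℚₚ.≤-trans (ℚₚ.≤-reflexive (sym (1^^ n))) (^^-monoˡ n (ℚₚ.nonNegative⁻¹ 1ℚ) 1≤a)

^^-monotone : ∀ {a m n} → 1ℚ ℚ.≤ a → m ≤ n → a ^^ m ℚ.≤ a ^^ n
^^-monotone {n = n} 1≤a z≤n       = ^^-≥1 n 1≤a
^^-monotone         1≤a (s≤s m≤n) = *-monoˡ (ℚₚ.≤-trans (ℚₚ.nonNegative⁻¹ 1ℚ) 1≤a) (^^-monotone 1≤a m≤n)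

module _ {B : Set} where

  ∑ : (B → ℚ) → List B → ℚ
  ∑ f []       = 0ℚ
  ∑ f (x ∷ xs) = f x ℚ.+ ∑ f xs

  ∑-++ : ∀ (f : B → ℚ) xs {ys} → ∑ f (xs ++ ys) ≡ ∑ f xs ℚ.+ ∑ f ys
  ∑-++ f []       = sym (ℚₚ.+-identityˡ _)
  ∑-++ f (x ∷ xs) = trans (cong (f x ℚ.+_) (∑-++ f xs)) (sym (ℚₚ.+-assoc (f x) _ _))

  ∑-cong : ∀ {f g : B → ℚ} → (∀ x → f x ≡ g x) → ∀ xs → ∑ f xs ≡ ∑ g xs
  ∑-cong f≡g []       = refl
  ∑-cong f≡g (x ∷ xs) = cong₂ ℚ._+_ (f≡g x) (∑-cong f≡g xs)

  ∑-mono : ∀ {f g : B → ℚ} xs → (∀ {x} → x ∈ xs → f x ℚ.≤ g x) → ∑ f xs ℚ.≤ ∑ g xs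
  ∑-mono []       _   = ℚₚ.≤-refl
  ∑-mono (x ∷ xs) f≤g = ℚₚ.+-mono-≤ (f≤g (here refl)) (∑-mono xs (f≤g ∘ there))

  ∑-zero : ∀ (xs : List B) → ∑ (λ _ → 0ℚ) xs ≡ 0ℚ
  ∑-zero []       = refl
  ∑-zero (_ ∷ xs) = trans (ℚₚ.+-identityˡ _) (∑-zero xs)

  ∑-+ : ∀ (f g : B → ℚ) xs → ∑ (λ x → f x ℚ.+ g x) xs ≡ ∑ f xs ℚ.+ ∑ g xs
  ∑-+ f g []       = sym (ℚₚ.+-identityˡ 0ℚ)
  ∑-+ f g (x ∷ xs) = begin
    (f x ℚ.+ g x) ℚ.+ ∑ (λ x → f x ℚ.+ g x) xs        ≡⟨ cong (f x ℚ.+ g x ℚ.+_) (∑-+ f g xs) ⟩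
    (f x ℚ.+ g x) ℚ.+ (∑ f xs ℚ.+ ∑ g xs)             ≡⟨ +-interchange (f x) (g x) _ _ ⟩
    (f x ℚ.+ ∑ f xs) ℚ.+ (g x ℚ.+ ∑ g xs)             ∎
    where
    open ≡-Reasoning

  ∑-*ˡ : ∀ a (f : B → ℚ) xs → ∑ (λ x → a ℚ.* f x) xs ≡ a ℚ.* ∑ f xs
  ∑-*ˡ a f []       = sym (ℚₚ.*-zeroʳ a)
  ∑-*ˡ a f (x ∷ xs) = trans (cong (a ℚ.* f x ℚ.+_) (∑-*ˡ a f xs)) (sym (ℚₚ.*-distribˡ-+ a (f x) _))

  ∑-nonNeg : ∀ {f : B → ℚ} → (∀ x → 0ℚ ℚ.≤ f x) → ∀ xs → 0ℚ ℚ.≤ ∑ f xs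
  ∑-nonNeg 0≤f xs = ℚₚ.≤-trans (ℚₚ.≤-reflexive (sym (∑-zero xs))) (∑-mono xs λ {x} _ → 0≤f x)

  ∑-∈ : ∀ {f : B → ℚ} → (∀ x → 0ℚ ℚ.≤ f x) → ∀ {x xs} → x ∈ xs → f x ℚ.≤ ∑ f xs
  ∑-∈ {f} 0≤f {x} {_ ∷ xs} (here refl) =
    ℚₚ.≤-trans (ℚₚ.≤-reflexive (sym (ℚₚ.+-identityʳ (f x)))) (ℚₚ.+-monoʳ-≤ (f x) (∑-nonNeg 0≤f xs))
  ∑-∈ {f} 0≤f {x} {y ∷ xs} (there x∈)  =
    ℚₚ.≤-trans (ℚₚ.≤-reflexive (sym (ℚₚ.+-identityˡ (f x)))) (ℚₚ.+-mono-≤ (0≤f y) (∑-∈ 0≤f x∈))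

∑-map : ∀ {B C : Set} (f : C → ℚ) (g : B → C) xs → ∑ f (map g xs) ≡ ∑ (f ∘ g) xs
∑-map f g []       = refl
∑-map f g (x ∷ xs) = cong (f (g x) ℚ.+_) (∑-map f g xs)

∑-cartesianProductWith : ∀ {B C D : Set} (f : D → ℚ) (g : B → C → D) (a : B → ℚ) (b : C → ℚ) →
  (∀ x y → f (g x y) ≡ a x ℚ.* b y) → ∀ xs ys →
  ∑ f (cartesianProductWith g xs ys) ≡ ∑ a xs ℚ.* ∑ b ys
∑-cartesianProductWith f g a b fg []       ys = sym (ℚₚ.*-zeroˡ (∑ b ys))
∑-cartesianProductWith f g a b fg (x ∷ xs) ys = begin
  ∑ f (map (g x) ys ++ cartesianProductWith g xs ys)         ≡⟨ ∑-++ f (map (g x) ys) ⟩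
  ∑ f (map (g x) ys) ℚ.+ ∑ f (cartesianProductWith g xs ys)  ≡⟨ cong₂ ℚ._+_ row (∑-cartesianProductWith f g a b fg xs ys) ⟩
  a x ℚ.* ∑ b ys ℚ.+ ∑ a xs ℚ.* ∑ b ys                       ≡⟨ ℚₚ.*-distribʳ-+ (∑ b ys) (a x) _ ⟨
  (a x ℚ.+ ∑ a xs) ℚ.* ∑ b ys                                ∎
  where
  open ≡-Reasoning
  row : ∑ f (map (g x) ys) ≡ a x ℚ.* ∑ b ys
  row = trans (∑-map f (g x) ys) (trans (∑-cong (fg x) ys) (∑-*ˡ (a x) b ys))

∑-allFin-suc : ∀ {n} (f : Fin (suc n) → ℚ) → ∑ f (allFin (suc n)) ≡ f zero ℚ.+ ∑ (f ∘ suc) (allFin n)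
∑-allFin-suc {n} f = cong (f zero ℚ.+_)
  (trans (cong (∑ f) (sym (map-tabulate id suc))) (∑-map f suc (allFin n)))

∑-indicator : ∀ {n} (b : Fin n) x → ∑ (λ a → if does (a ≟ b) then x else 0ℚ) (allFin n) ≡ x
∑-indicator {suc n} zero x = trans (∑-allFin-suc {n} (λ a → if does (a ≟ zero) then x else 0ℚ))
  (trans (cong (x ℚ.+_) (∑-zero (allFin n))) (ℚₚ.+-identityʳ x))
∑-indicator {suc n} (suc b) x = trans (∑-allFin-suc {n} (λ a → if does (a ≟ suc b) then x else 0ℚ))
  (trans (ℚₚ.+-identityˡ _) (∑-indicator b x))

-- Miller's criterion

-- The number `m` as a rational, written as a sum of ones to be compared termwise with a sum of
-- potentials over the letters.
card : ℕ → ℚ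
card m = ∑ (λ _ → 1ℚ) (allFin m)

module _ {m : ℕ} where

  -- The Brzozowski derivative, on lists with repetitions: distinct morphisms may yield equal words,
  -- and each copy carries its own weight.
  derivative : Fin m → List (List (Fin m)) → List (List (Fin m))
  derivative a []              = []
  derivative a ([] ∷ P)        = derivative a P
  derivative a ((b ∷ ρ) ∷ P) = (if does (a ≟ b) then ρ ∷_ else id) (derivative a P)

  derivative-∈ : ∀ {a ρ P} → (a ∷ ρ) ∈ P → ρ ∈ derivative a P
  derivative-∈ {a} (here refl) with a ≟ a
  ... | yes _   = here refl
  ... | no  a≢a = contradiction refl a≢a
  derivative-∈ {a} {P = [] ∷ P}      (there i) = derivative-∈ i
  derivative-∈ {a} {P = (b ∷ ρ) ∷ P} (there i) with does (a ≟ b)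
  ... | true  = there (derivative-∈ i)
  ... | false = derivative-∈ i

  module _ (c : ℚ) (0≤c : 0ℚ ℚ.≤ c) where

    weight : List (Fin m) → ℚ
    weight ρ = c ^^ length ρ

    weight-nonNeg : ∀ ρ → 0ℚ ℚ.≤ weight ρ
    weight-nonNeg ρ = ^^-nonNeg (length ρ) 0≤c

    potential : List (List (Fin m)) → ℚ
    potential = ∑ weight

    potential-derivative : ∀ a b ρ P → potential (derivative a ((b ∷ ρ) ∷ P)) ≡
      (if does (a ≟ b) then weight ρ else 0ℚ) ℚ.+ potential (derivative a P)
    potential-derivative a b ρ P with does (a ≟ b)
    ... | true  = refl
    ... | false = sym (ℚₚ.+-identityˡ _)

    -- A word `b ∷ ρ` survives only in the derivative by `b`, and the factor `c` restores the letter
    -- lost there. Empty words survive in none, hence only an inequality.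
    ∑-derivative : ∀ P → c ℚ.* ∑ (λ a → potential (derivative a P)) (allFin m) ℚ.≤ potential P
    ∑-derivative [] = ℚₚ.≤-reflexive (trans (cong (c ℚ.*_) (∑-zero (allFin m))) (ℚₚ.*-zeroʳ c))
    ∑-derivative ([] ∷ P) = begin
      c ℚ.* ∑ (λ a → potential (derivative a P)) (allFin m)   ≤⟨ ∑-derivative P ⟩
      potential P                                             ≡⟨ ℚₚ.+-identityˡ _ ⟨
      0ℚ ℚ.+ potential P                                      ≤⟨ ℚₚ.+-monoˡ-≤ (potential P) (ℚₚ.nonNegative⁻¹ 1ℚ) ⟩
      1ℚ ℚ.+ potential P                                      ∎
      where open ℚₚ.≤-Reasoning
    ∑-derivative ((b ∷ ρ) ∷ P) = begin
      c ℚ.* ∑ (λ a → potential (derivative a ((b ∷ ρ) ∷ P))) as    ≡⟨ cong (c ℚ.*_) (∑-cong (λ a → potential-derivative a b ρ P) as) ⟩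
      c ℚ.* ∑ (λ a → δ a ℚ.+ potential (derivative a P)) as        ≡⟨ cong (c ℚ.*_) (∑-+ δ _ as) ⟩
      c ℚ.* (∑ δ as ℚ.+ ∑ (λ a → potential (derivative a P)) as)   ≡⟨ ℚₚ.*-distribˡ-+ c _ _ ⟩
      c ℚ.* ∑ δ as ℚ.+ c ℚ.* ∑ (λ a → potential (derivative a P)) as ≤⟨ ℚₚ.+-monoʳ-≤ (c ℚ.* ∑ δ as) (∑-derivative P) ⟩
      c ℚ.* ∑ δ as ℚ.+ potential P                                 ≡⟨ cong (λ x → c ℚ.* x ℚ.+ potential P) (∑-indicator b (weight ρ)) ⟩
      c ℚ.* weight ρ ℚ.+ potential P                               ∎
      where
      open ℚₚ.≤-Reasoning
      as = allFin m
      δ : Fin m → ℚ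
      δ a = if does (a ≟ b) then weight ρ else 0ℚ

    module _ (S : ℚ) (S<1 : S ℚ.< 1ℚ) (1+S≤cm : 1ℚ ℚ.+ S ℚ.≤ c ℚ.* card m) where

      -- If all `m` derivatives had potential at least 1, then `c` times their sum would be at least
      -- `c m ≥ 1 + S`; by `∑-derivative` it is at most the potential of `P ++ N`, which is below
      -- `1 + S`.
      chooseLetter : ∀ P N → potential P ℚ.< 1ℚ → potential N ℚ.≤ S →
                     ∃ λ a → potential (derivative a (P ++ N)) ℚ.< 1ℚ
      chooseLetter P N P<1 N≤S with any? (λ a → potential (derivative a (P ++ N)) ℚₚ.<? 1ℚ)
      ... | yes found = found
      ... | no  none  = contradiction (begin-strict
        c ℚ.* card m                                                  ≤⟨ *-monoˡ 0≤c (∑-mono (allFin m) λ {a} _ → ℚₚ.≮⇒≥ λ lt → none (a , lt)) ⟩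
        c ℚ.* ∑ (λ a → potential (derivative a (P ++ N))) (allFin m)  ≤⟨ ∑-derivative (P ++ N) ⟩
        potential (P ++ N)                                            ≡⟨ ∑-++ weight P ⟩
        potential P ℚ.+ potential N                                   <⟨ ℚₚ.+-mono-<-≤ P<1 N≤S ⟩
        1ℚ ℚ.+ S                                                      ≤⟨ 1+S≤cm ⟩
        c ℚ.* card m                                                  ∎) (ℚₚ.<-irrefl refl)
        where open ℚₚ.≤-Reasoning

      -- A forbidden word read to its end would leave the empty word, of weight 1, among the pending
      -- ones, whose total weight stays below 1.
      avoidFrom : ∀ (N : ℕ → List (List (Fin m))) → (∀ t → potential (N t) ℚ.≤ S) →
                  Σ (InfWord m) λ w → ∀ t ρ → ρ ∈ N t → ¬ Occurs w t ρ
      avoidFrom N N≤S = w , avoids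
        where
        -- The unread parts of the forbidden words started before t and matched so far.
        pending : ℕ → ∃ λ P → potential P ℚ.< 1ℚ
        letterAt : ∀ t → ∃ λ a → potential (derivative a (proj₁ (pending t) ++ N t)) ℚ.< 1ℚ
        pending zero    = [] , ℚₚ.positive⁻¹ 1ℚ
        pending (suc t) = derivative (proj₁ (letterAt t)) (proj₁ (pending t) ++ N t) , proj₂ (letterAt t)
        letterAt t = chooseLetter (proj₁ (pending t)) (N t) (proj₂ (pending t)) (N≤S t)

        w : InfWord m
        w t = proj₁ (letterAt t)

        pendingAvoided : ∀ t ρ → ρ ∈ proj₁ (pending t) → ¬ Occurs w t ρ
        pendingAvoided t []      i _          = contradiction
          (ℚₚ.≤-<-trans (∑-∈ weight-nonNeg i) (proj₂ (pending t))) (ℚₚ.<-irrefl refl)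
        pendingAvoided t (_ ∷ ρ) i (refl ∷ o) =
          pendingAvoided (suc t) ρ (derivative-∈ (∈-++⁺ˡ i)) o

        avoids : ∀ t ρ → ρ ∈ N t → ¬ Occurs w t ρ
        -- Each member of `N t` weighs at most `S < 1`, so the empty word is not one of them.
        avoids t []      i _          = contradiction
          (ℚₚ.≤-<-trans (∑-∈ weight-nonNeg i) (ℚₚ.≤-<-trans (N≤S t) S<1)) (ℚₚ.<-irrefl refl)
        avoids t (_ ∷ ρ) i (refl ∷ o) =
          pendingAvoided (suc t) ρ (derivative-∈ (∈-++⁺ʳ (proj₁ (pending t)) i)) o

-- Lengths of instances of patterns

sum-mono : ∀ {k} {f g : Fin k → ℕ} → (∀ X → f X ≤ g X) → sum f ≤ sum g
sum-mono {zero}  f≤g = z≤n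
sum-mono {suc k} f≤g = +-mono-≤ (f≤g zero) (sum-mono (f≤g ∘ suc))

sum-upper : ∀ {k} (f : Fin k → ℕ) X → f X ≤ sum f
sum-upper f zero    = m≤m+n (f zero) _
sum-upper f (suc X) = ≤-trans (sum-upper (f ∘ suc) X) (m≤n+m _ (f zero))

sum-const : ∀ k c → sum {k} (λ _ → c) ≡ k * c
sum-const zero    c = refl
sum-const (suc k) c = cong (c +_) (sum-const k c)

sum-*ˡ : ∀ {k} c (f : Fin k → ℕ) → sum (λ X → c * f X) ≡ c * sum f
sum-*ˡ {zero}  c f = sym (*-zeroʳ c)
sum-*ˡ {suc k} c f = trans (cong (c * f zero +_) (sum-*ˡ c (f ∘ suc))) (sym (*-distribˡ-+ c (f zero) _))

indicator : ∀ {k} → Fin k → Fin k → ℕ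
indicator X Y = if does (X ≟ Y) then 1 else 0

sum-indicator : ∀ {k} (f : Fin k → ℕ) Y → sum (λ X → indicator X Y * f X) ≡ f Y
sum-indicator {suc k} f zero    = begin
  f zero + 0 + sum {k} (λ _ → 0)  ≡⟨ cong₂ _+_ (+-identityʳ (f zero)) (sum-replicate-zero k) ⟩
  f zero + 0                      ≡⟨ +-identityʳ (f zero) ⟩
  f zero                          ∎
  where open ≡-Reasoning
sum-indicator {suc k} f (suc Y) = sum-indicator (f ∘ suc) Y

count : ∀ {k} → Fin k → List (Fin k) → ℕ
count X p = List.sum (map (indicator X) p)

-- Double counting: the letters of `p` are grouped by variable.
sum-count : ∀ {k} (f : Fin k → ℕ) p → sum (λ X → count X p * f X) ≡ List.sum (map f p)
sum-count {k} f []      = sum-replicate-zero k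
sum-count {k} f (Y ∷ p) = begin
  sum (λ X → (indicator X Y + count X p) * f X)                   ≡⟨ sum-cong-≗ (λ X → *-distribʳ-+ (f X) (indicator X Y) (count X p)) ⟩
  sum (λ X → indicator X Y * f X + count X p * f X)               ≡⟨ ∑-distrib-+ (λ X → indicator X Y * f X) _ ⟩
  sum (λ X → indicator X Y * f X) + sum (λ X → count X p * f X)   ≡⟨ cong₂ _+_ (sum-indicator f Y) (sum-count f p) ⟩
  f Y + List.sum (map f p)                                        ∎
  where open ≡-Reasoning

sum-count-length : ∀ {k} (p : List (Fin k)) → sum (λ X → count X p) ≡ length p
sum-count-length p = trans (sum-cong-≗ (λ X → sym (*-identityʳ (count X p)))) (trans (sum-count (λ _ → 1) p) (ones p))
  where
  ones : ∀ {A : Set} (p : List A) → List.sum (map (λ _ → 1) p) ≡ length p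
  ones []      = refl
  ones (_ ∷ p) = cong suc (ones p)

length-concatMap : ∀ {A B : Set} (h : A → List B) p → length (concatMap h p) ≡ List.sum (map (length ∘ h) p)
length-concatMap h []      = refl
length-concatMap h (X ∷ p) = trans (length-++ (h X)) (cong (length (h X) +_) (length-concatMap h p))

totalLength : ∀ {k} {A : Set} → (Fin k → List A) → ℕ
totalLength h = sum (length ∘ h)

-- Summing (d - 2)(ℓ - 1) ≥ 0 over the variables, with d the multiplicity and ℓ the length of the image.
instance-length : ∀ {k} {A : Set} (p : List (Fin k)) (h : Fin k → List A) →
  (∀ X → 2 ≤ count X p) → (∀ X → 1 ≤ length (h X)) →
  length p + 2 * totalLength h ≤ length (concatMap h p) + k * 2
instance-length {k} p h 2≤d 1≤ℓ = begin
  length p + 2 * totalLength h                                ≡⟨ cong₂ _+_ (sum-count-length p) (sum-*ˡ 2 (length ∘ h)) ⟨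
  sum (λ X → count X p) + sum (λ X → 2 * length (h X))        ≡⟨ ∑-distrib-+ (λ X → count X p) _ ⟨
  sum (λ X → count X p + 2 * length (h X))                    ≤⟨ sum-mono (λ X → perVariable (2≤d X) (1≤ℓ X)) ⟩
  sum (λ X → count X p * length (h X) + 2)                    ≡⟨ ∑-distrib-+ (λ X → count X p * length (h X)) _ ⟩
  sum (λ X → count X p * length (h X)) + sum {k} (λ _ → 2)    ≡⟨ cong₂ _+_ (trans (sum-count (length ∘ h) p) (sym (length-concatMap h p))) (sum-const k 2) ⟩
  length (concatMap h p) + k * 2                              ∎
  where
  open ≤-Reasoning
  expand : ∀ d ℓ → suc (suc d) * suc ℓ + 2 ≡ suc (suc d) + 2 * suc ℓ + d * ℓ
  expand = solve-∀

  perVariable : ∀ {d ℓ} → 2 ≤ d → 1 ≤ ℓ → d + 2 * ℓ ≤ d * ℓ + 2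
  perVariable {suc (suc d)} {suc ℓ} _ _ = ≤-trans (m≤m+n _ (d * ℓ)) (≤-reflexive (sym (expand d ℓ)))
  perVariable {suc zero} (s≤s ())

-- Enumeration of morphisms

module _ {m : ℕ} where

  nonEmptyWords : ℕ → List (List (Fin m))
  nonEmptyWords zero    = []
  nonEmptyWords (suc B) = cartesianProductWith _∷_ (allFin m) ([] ∷ nonEmptyWords B)

  ∈-nonEmptyWords : ∀ {B} u → NonEmpty u → length u ≤ B → u ∈ nonEmptyWords B
  ∈-nonEmptyWords []          ne _         = contradiction refl ne
  ∈-nonEmptyWords (x ∷ [])    _  (s≤s _)   = ∈-cartesianProductWith⁺ _∷_ (∈-allFin x) (here refl)
  ∈-nonEmptyWords (x ∷ y ∷ u) _  (s≤s u≤B) =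
    ∈-cartesianProductWith⁺ _∷_ (∈-allFin x) (there (∈-nonEmptyWords (y ∷ u) (λ ()) u≤B))

  nonEmptyWords-length : ∀ B {u} → u ∈ nonEmptyWords B → 1 ≤ length u
  nonEmptyWords-length (suc B) u∈
    with _ , _ , _ , _ , refl ← ∈-cartesianProductWith⁻ _∷_ (allFin m) ([] ∷ nonEmptyWords B) u∈ = z<s

  -- Morphisms are stored as vectors, because membership in a list of functions would ask for more
  -- than pointwise equality.
  assignments : ∀ k → ℕ → List (Vec (List (Fin m)) k)
  assignments zero    B = [] ∷ []
  assignments (suc k) B = cartesianProductWith _∷_ (nonEmptyWords B) (assignments k B)

  ∈-assignments : ∀ {k B} (h : Fin k → List (Fin m)) → NonErasing h → (∀ X → length (h X) ≤ B) →
                  Vec.tabulate h ∈ assignments k B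
  ∈-assignments {zero}  h ne h≤B = here refl
  ∈-assignments {suc k} h ne h≤B = ∈-cartesianProductWith⁺ _∷_
    (∈-nonEmptyWords (h zero) (ne zero) (h≤B zero)) (∈-assignments (h ∘ suc) (ne ∘ suc) (h≤B ∘ suc))

  assignments-length : ∀ k B {v} → v ∈ assignments k B → ∀ X → 1 ≤ length (lookup v X)
  assignments-length (suc k) B v∈ X
    with _ , _ , u∈ , v′∈ , refl ← ∈-cartesianProductWith⁻ _∷_ (nonEmptyWords B) (assignments k B) v∈
    with X
  ... | zero   = nonEmptyWords-length B u∈
  ... | suc X′ = assignments-length k B v′∈ X′

  module _ (y s : ℚ) (0≤y : 0ℚ ℚ.≤ y) (0≤s : 0ℚ ℚ.≤ s)
           (geometric : ∑ (λ _ → y) (allFin m) ℚ.* (1ℚ ℚ.+ s) ℚ.≤ s) where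

    -- The sum up to length `B + 1` is `m y` times one plus the sum up to `B`. So a solution of
    -- `m y (1 + s) ≤ s` bounds all partial sums of the geometric series by induction.
    ∑-nonEmptyWords : ∀ B → ∑ (λ u → y ^^ length u) (nonEmptyWords B) ℚ.≤ s
    ∑-nonEmptyWords zero    = 0≤s
    ∑-nonEmptyWords (suc B) = begin
      ∑ (λ u → y ^^ length u) (nonEmptyWords (suc B))
        ≡⟨ ∑-cartesianProductWith (λ u → y ^^ length u) _∷_ (λ _ → y) (λ u → y ^^ length u) (λ _ _ → refl) (allFin m) ([] ∷ nonEmptyWords B) ⟩
      ∑ (λ _ → y) (allFin m) ℚ.* (1ℚ ℚ.+ ∑ (λ u → y ^^ length u) (nonEmptyWords B))
        ≤⟨ *-monoˡ (∑-nonNeg (λ _ → 0≤y) (allFin m)) (ℚₚ.+-monoʳ-≤ 1ℚ (∑-nonEmptyWords B)) ⟩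
      ∑ (λ _ → y) (allFin m) ℚ.* (1ℚ ℚ.+ s)
        ≤⟨ geometric ⟩
      s ∎
      where open ℚₚ.≤-Reasoning

    -- The weight is multiplicative over the variables, so the sum factors into one geometric sum
    -- per variable.
    ∑-assignments : ∀ k B → ∑ (λ v → y ^^ totalLength (lookup v)) (assignments k B) ℚ.≤ s ^^ k
    ∑-assignments zero    B = ℚₚ.≤-reflexive (ℚₚ.+-identityʳ 1ℚ)
    ∑-assignments (suc k) B = begin
      ∑ (λ v → y ^^ totalLength (lookup v)) (assignments (suc k) B)
        ≡⟨ ∑-cartesianProductWith (λ v → y ^^ totalLength (lookup v)) _∷_ (λ u → y ^^ length u)
             (λ v → y ^^ totalLength (lookup v)) (λ u v → ^^-homo-* y (length u) _) (nonEmptyWords B) (assignments k B) ⟩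
      ∑ (λ u → y ^^ length u) (nonEmptyWords B) ℚ.* ∑ (λ v → y ^^ totalLength (lookup v)) (assignments k B)
        ≤⟨ *-mono 0≤s (∑-nonNeg (λ v → ^^-nonNeg (totalLength (lookup v)) 0≤y) (assignments k B)) (∑-nonEmptyWords B) (∑-assignments k B) ⟩
      s ℚ.* s ^^ k ∎
      where open ℚₚ.≤-Reasoning

-- Patterns in which every variable occurs at least twice

-- The price of tracking an instance of length n only from its (e + 1)-st letter on.
delay-cost : ∀ {c Q} → 0ℚ ℚ.≤ c → 1ℚ ℚ.≤ Q → 1ℚ ℚ.≤ c ℚ.* Q →
             ∀ n e → c ^^ (n ∸ e) ℚ.≤ c ^^ n ℚ.* Q ^^ e
delay-cost {c} {Q} 0≤c 1≤Q 1≤cQ n zero = ℚₚ.≤-reflexive (sym (ℚₚ.*-identityʳ (c ^^ n)))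
delay-cost {c} {Q} 0≤c 1≤Q 1≤cQ zero (suc e) =
  ℚₚ.≤-trans (^^-≥1 (suc e) 1≤Q) (ℚₚ.≤-reflexive (sym (ℚₚ.*-identityˡ (Q ^^ suc e))))
delay-cost {c} {Q} 0≤c 1≤Q 1≤cQ (suc n) (suc e) = begin
  c ^^ (n ∸ e)                              ≤⟨ delay-cost 0≤c 1≤Q 1≤cQ n e ⟩
  c ^^ n ℚ.* Q ^^ e                         ≡⟨ ℚₚ.*-identityˡ _ ⟨
  1ℚ ℚ.* (c ^^ n ℚ.* Q ^^ e)                ≤⟨ *-mono (ℚₚ.≤-trans (ℚₚ.nonNegative⁻¹ 1ℚ) 1≤cQ) 0≤ 1≤cQ ℚₚ.≤-refl ⟩
  c ℚ.* Q ℚ.* (c ^^ n ℚ.* Q ^^ e)           ≡⟨ *-interchange c Q (c ^^ n) (Q ^^ e) ⟩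
  c ^^ suc n ℚ.* Q ^^ suc e                 ∎
  where
  open ℚₚ.≤-Reasoning
  0≤ : 0ℚ ℚ.≤ c ^^ n ℚ.* Q ^^ e
  0≤ = *-nonNeg (^^-nonNeg n 0≤c) (^^-nonNeg e (ℚₚ.≤-trans (ℚₚ.nonNegative⁻¹ 1ℚ) 1≤Q))

-- Weights are powers of c, q^K ≥ 1/c pays for a delay by the fraction 1/K of the letters, s bounds the
-- geometric series Σ (m c² q)^ℓ over ℓ ≥ 1, and S bounds the weight of all instances of a pattern with
-- at least k₀ variables.
record Budget (m k₀ a : ℕ) : Set where
  field
    c q s S   : ℚ
    K         : ℕ
    {{K≢0}}   : NonZero K
    0≤c       : 0ℚ ℚ.≤ c
    c≤1       : c ℚ.≤ 1ℚ
    1≤q       : 1ℚ ℚ.≤ q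
    0≤s       : 0ℚ ℚ.≤ s
    S<1       : S ℚ.< 1ℚ
    delay     : 1ℚ ℚ.≤ c ℚ.* q ^^ K
    geometric : ∑ (λ _ → c ^^ 2 ℚ.* q) (allFin m) ℚ.* (1ℚ ℚ.+ s) ℚ.≤ s
    cs≤1      : c ℚ.* s ℚ.≤ 1ℚ
    base      : c ^^ a ℚ.* s ^^ k₀ ℚ.≤ S
    growth    : 1ℚ ℚ.+ S ℚ.≤ c ℚ.* card m

module _ {m k₀ a : ℕ} (budget : Budget m k₀ a) where
  open Budget budget

  private
    0≤q : 0ℚ ℚ.≤ q
    0≤q = ℚₚ.≤-trans (ℚₚ.nonNegative⁻¹ 1ℚ) 1≤q

    y : ℚ
    y = c ^^ 2 ℚ.* q

    0≤y : 0ℚ ℚ.≤ y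
    0≤y = *-nonNeg (^^-nonNeg 2 0≤c) 0≤q

  -- Each variable beyond `k₀` multiplies the bound by `c s ≤ 1`.
  mass-bound : ∀ j → c ^^ (a + j) ℚ.* s ^^ (k₀ + j) ℚ.≤ S
  mass-bound j = begin
    c ^^ (a + j) ℚ.* s ^^ (k₀ + j)                    ≡⟨ cong₂ ℚ._*_ (^^-homo-* c a j) (^^-homo-* s k₀ j) ⟩
    (c ^^ a ℚ.* c ^^ j) ℚ.* (s ^^ k₀ ℚ.* s ^^ j)      ≡⟨ *-interchange (c ^^ a) (c ^^ j) (s ^^ k₀) (s ^^ j) ⟩
    (c ^^ a ℚ.* s ^^ k₀) ℚ.* (c ^^ j ℚ.* s ^^ j)      ≡⟨ cong (c ^^ a ℚ.* s ^^ k₀ ℚ.*_) (^^-distrib-* c s j) ⟨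
    (c ^^ a ℚ.* s ^^ k₀) ℚ.* (c ℚ.* s) ^^ j           ≤⟨ *-monoˡ 0≤base (^^-antitone {m = 0} {n = j} 0≤cs cs≤1 z≤n) ⟩
    (c ^^ a ℚ.* s ^^ k₀) ℚ.* 1ℚ                       ≡⟨ ℚₚ.*-identityʳ _ ⟩
    c ^^ a ℚ.* s ^^ k₀                                ≤⟨ base ⟩
    S                                                ∎
    where
    open ℚₚ.≤-Reasoning
    0≤cs = *-nonNeg 0≤c 0≤s
    0≤base = *-nonNeg (^^-nonNeg a 0≤c) (^^-nonNeg k₀ 0≤s)

  module _ (j : ℕ) (p : List (Fin (k₀ + j))) (2≤count : ∀ X → 2 ≤ count X p)
           (long : (k₀ + j) * 2 + (a + j) ≤ length p) where

    private
      k = k₀ + j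

      τ : Vec (List (Fin m)) k → List (Fin m)
      τ v = concatMap (lookup v) p

    -- Since the onset grows with the instance, finitely many instances have to be tracked at each time.
    onset : Vec (List (Fin m)) k → ℕ
    onset v = totalLength (lookup v) / K

    forbidden : ℕ → List (List (Fin m))
    forbidden t = map (λ v → drop (onset v) (τ v)) (assignments k (suc t * K))

    -- With `T` the total length of the images, `instance-length` and `long` make the instance at
    -- least `a + j + 2T` letters long. The delay costs at most `q ^^ T`, as `K * onset v ≤ T`; what
    -- depends on `T` combines to `y ^^ T`.
    weight-bound : ∀ v → (∀ X → 1 ≤ length (lookup v X)) →
      c ^^ length (drop (onset v) (τ v)) ℚ.≤ c ^^ (a + j) ℚ.* y ^^ totalLength (lookup v)
    weight-bound v 1≤ℓ = begin
      c ^^ length (drop e (τ v))                        ≡⟨ cong (c ^^_) (length-drop e (τ v)) ⟩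
      c ^^ (length (τ v) ∸ e)                           ≤⟨ delay-cost 0≤c (^^-≥1 K 1≤q) delay (length (τ v)) e ⟩
      c ^^ length (τ v) ℚ.* (q ^^ K) ^^ e               ≤⟨ *-mono (^^-nonNeg (a + j + 2 * T) 0≤c) (^^-nonNeg e (^^-nonNeg K 0≤q)) (^^-antitone 0≤c c≤1 longInstance) q-power ⟩
      c ^^ (a + j + 2 * T) ℚ.* q ^^ T                   ≡⟨ cong (ℚ._* q ^^ T) (trans (^^-homo-* c (a + j) (2 * T)) (cong (c ^^ (a + j) ℚ.*_) (sym (^^-assocʳ c 2 T)))) ⟩
      c ^^ (a + j) ℚ.* (c ^^ 2) ^^ T ℚ.* q ^^ T         ≡⟨ ℚₚ.*-assoc (c ^^ (a + j)) _ _ ⟩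
      c ^^ (a + j) ℚ.* ((c ^^ 2) ^^ T ℚ.* q ^^ T)       ≡⟨ cong (c ^^ (a + j) ℚ.*_) (^^-distrib-* (c ^^ 2) q T) ⟨
      c ^^ (a + j) ℚ.* y ^^ T                           ∎
      where
      open ℚₚ.≤-Reasoning
      T = totalLength (lookup v)
      e = onset v

      q-power : (q ^^ K) ^^ e ℚ.≤ q ^^ T
      q-power = ℚₚ.≤-trans (ℚₚ.≤-reflexive (^^-assocʳ q K e))
        (^^-monotone 1≤q (≤-trans (≤-reflexive (*-comm K e)) (m/n*n≤m T K)))

      longInstance : a + j + 2 * T ≤ length (τ v)
      longInstance = +-cancelˡ-≤ (k * 2) _ _ (≤-trans
        (≤-reflexive (sym (+-assoc (k * 2) (a + j) (2 * T))))
        (≤-trans (+-monoˡ-≤ (2 * T) long)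
        (≤-trans (instance-length p (lookup v) 2≤count 1≤ℓ) (≤-reflexive (+-comm _ (k * 2))))))

    forbidden-mass : ∀ t → potential c 0≤c (forbidden t) ℚ.≤ S
    forbidden-mass t = begin
      ∑ (λ ρ → c ^^ length ρ) (forbidden t)                       ≡⟨ ∑-map _ _ vs ⟩
      ∑ (λ v → c ^^ length (drop (onset v) (τ v))) vs             ≤⟨ ∑-mono vs (λ {v} v∈ → weight-bound v (assignments-length k (suc t * K) v∈)) ⟩
      ∑ (λ v → c ^^ (a + j) ℚ.* y ^^ totalLength (lookup v)) vs   ≡⟨ ∑-*ˡ (c ^^ (a + j)) _ vs ⟩
      c ^^ (a + j) ℚ.* ∑ (λ v → y ^^ totalLength (lookup v)) vs   ≤⟨ *-monoˡ (^^-nonNeg (a + j) 0≤c) (∑-assignments y s 0≤y 0≤s geometric k (suc t * K)) ⟩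
      c ^^ (a + j) ℚ.* s ^^ k                                     ≤⟨ mass-bound j ⟩
      S                                                           ∎
      where
      open ℚₚ.≤-Reasoning
      vs = assignments k (suc t * K)

    -- If an instance occurs at `i` and has onset `e`, its tail occurs at `i + e`. There the
    -- morphism is among the enumerated ones: each image has at most `T < (e + 1) K ≤ (i + e + 1) K`
    -- letters.
    avoidable-doubled : ∃ λ (w : InfWord m) → Avoiding w p
    avoidable-doubled with avoidFrom c 0≤c S S<1 growth forbidden forbidden-mass
    ... | w , avoids = w , λ i h ne o →
      let v = Vec.tabulate h
          e = onset v
          h≡v : ∀ X → lookup v X ≡ h X
          h≡v = lookup∘tabulate h
          T = totalLength (lookup v)
          T< : T < suc e * K
          T< = ≤-trans (≤-reflexive (cong suc (m≡m%n+[m/n]*n T K))) (+-monoˡ-≤ (e * K) (m%n<n T K))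
          short : ∀ X → length (h X) ≤ suc (i + e) * K
          short X = ≤-trans (≤-reflexive (cong length (sym (h≡v X))))
            (≤-trans (sum-upper (length ∘ lookup v) X)
            (≤-trans (<⇒≤ T<) (*-monoˡ-≤ K (s≤s (m≤n+m e i)))))
      in avoids (i + e) (drop e (τ v)) (∈-map⁺ _ (∈-assignments h ne short))
           (occurs-drop e (subst (Occurs w i) (sym (concatMap-cong h≡v p)) o))

-- A binary word without squares of period at least 3

pattern 0̂ = zero
pattern 1̂ = suc zero
pattern 2̂ = suc (suc zero)

-- Found by a computer search over 12-uniform morphisms.
block : Fin 3 → List (Fin 2)
block 0̂ = 0̂ ∷ 1̂ ∷ 0̂ ∷ 1̂ ∷ 0̂ ∷ 1̂ ∷ 0̂ ∷ 0̂ ∷ 0̂ ∷ 1̂ ∷ 1̂ ∷ 1̂ ∷ []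
block 1̂ = 0̂ ∷ 1̂ ∷ 0̂ ∷ 1̂ ∷ 0̂ ∷ 1̂ ∷ 1̂ ∷ 1̂ ∷ 0̂ ∷ 0̂ ∷ 0̂ ∷ 0̂ ∷ []
block 2̂ = 0̂ ∷ 1̂ ∷ 0̂ ∷ 1̂ ∷ 0̂ ∷ 1̂ ∷ 1̂ ∷ 1̂ ∷ 1̂ ∷ 0̂ ∷ 0̂ ∷ 0̂ ∷ []

-- The default past the end is harmless: the finite checks below index only inside their words.
nth : List (Fin 2) → ℕ → Fin 2
nth []      _       = zero
nth (x ∷ u) zero    = x
nth (x ∷ u) (suc n) = nth u n

allBelow? : ∀ {P : ℕ → Set} → (∀ n → Dec (P n)) → ∀ v → Dec (∀ n → n < v → P n)
allBelow? P? v = map′ (λ f n n<v → f n<v) (λ f {n} n<v → f n n<v) (allUpTo? P? v)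

Agree : (ℕ → Fin 2) → (ℕ → Fin 2) → ℕ → Set
Agree u v n = ∀ j → j < n → u j ≡ v j

agree? : ∀ u v n → Dec (Agree u v n)
agree? u v = allBelow? λ j → u j ≟ v j

-- Blocks mark their own boundaries: inside two consecutive blocks, no block starts at an offset
-- from 1 to 11. This is decided by evaluation, like the four finite checks that follow.
synchronizing : ∀ a b c r → r < 11 →
  ¬ Agree (nth (block a)) (λ j → nth (concatMap block (b ∷ c ∷ [])) (suc r + j)) 12
synchronizing = toWitness {a? = all? λ a → all? λ b → all? λ c → allBelow? (λ r →
  ¬? (agree? (nth (block a)) (λ j → nth (concatMap block (b ∷ c ∷ [])) (suc r + j)) 12)) 11} tt

block-injective : ∀ a b → Agree (nth (block a)) (nth (block b)) 12 → a ≡ b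
block-injective = toWitness {a? = all? λ a → all? λ b →
  agree? (nth (block a)) (nth (block b)) 12 →-dec (a ≟ b)} tt

-- A block cut at `r` can be identified from one of its two pieces: from the suffix if `r ≤ 8`, from
-- the prefix if `r ≥ 9`.
cut-determined : ∀ a b c r → r < 12 →
  Agree (λ j → nth (block a) (r + j)) (λ j → nth (block b) (r + j)) (12 ∸ r) →
  Agree (nth (block b)) (nth (block c)) r → a ≡ b ⊎ b ≡ c
cut-determined = toWitness {a? = all? λ a → all? λ b → all? λ c → allBelow? (λ r →
  agree? (λ j → nth (block a) (r + j)) (λ j → nth (block b) (r + j)) (12 ∸ r) →-dec
  (agree? (nth (block b)) (nth (block c)) r →-dec ((a ≟ b) ⊎-dec (b ≟ c)))) 12} tt

-- A square of period 3 to 23 starting in the first block ends within five blocks. The hypotheses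
-- say that `a b c d e` is square-free; they alternate with the quantifiers so that the evaluation
-- discards bad prefixes early.
shortSquares : ∀ a b → a ≢ b → ∀ c → b ≢ c → ∀ d → c ≢ d → ¬ (a ≡ c × b ≡ d) →
  ∀ e → d ≢ e → ¬ (b ≡ d × c ≡ e) → ∀ m → m < 21 → ∀ r → r < 12 →
  let L = nth (concatMap block (a ∷ b ∷ c ∷ d ∷ e ∷ [])) in
  ¬ Agree (λ j → L (r + j)) (λ j → L (r + (3 + m) + j)) (3 + m)
shortSquares = toWitness {a? = all? λ a → all? λ b → ¬? (a ≟ b) →-dec
  all? λ c → ¬? (b ≟ c) →-dec all? λ d → ¬? (c ≟ d) →-dec (¬? ((a ≟ c) ×-dec (b ≟ d)) →-dec
  all? λ e → ¬? (d ≟ e) →-dec (¬? ((b ≟ d) ×-dec (c ≟ e)) →-dec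
  allBelow? (λ m → allBelow? (λ r →
    let L = nth (concatMap block (a ∷ b ∷ c ∷ d ∷ e ∷ [])) in
    ¬? (agree? (λ j → L (r + j)) (λ j → L (r + (3 + m) + j)) (3 + m))) 12) 21))} tt

occurs? : ∀ (w : ℕ → Fin 2) i u → Dec (Occurs w i u)
occurs? w i []      = yes []
occurs? w i (x ∷ u) = map′ (uncurry _∷_) (λ { (e ∷ o) → e , o }) ((x ≟ w i) ×-dec occurs? w (suc i) u)

pair : List (Fin 2) → List (Fin 2) → Fin 2 → List (Fin 2)
pair A B 0̂ = A
pair A B 1̂ = B

-- Up to exchanging the variables, the overlap-free binary patterns of length 6 except AABAAB, ABAABA
-- and ABBABB, which are squares of words of length 3.
hardPatterns : List (List (Fin 2))
hardPatterns =
  (0̂ ∷ 1̂ ∷ 0̂ ∷ 1̂ ∷ 1̂ ∷ 0̂ ∷ []) ∷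
  (0̂ ∷ 1̂ ∷ 1̂ ∷ 0̂ ∷ 1̂ ∷ 0̂ ∷ []) ∷
  (0̂ ∷ 0̂ ∷ 1̂ ∷ 0̂ ∷ 1̂ ∷ 1̂ ∷ []) ∷
  (0̂ ∷ 0̂ ∷ 1̂ ∷ 1̂ ∷ 0̂ ∷ 1̂ ∷ []) ∷
  (0̂ ∷ 1̂ ∷ 0̂ ∷ 0̂ ∷ 1̂ ∷ 1̂ ∷ []) ∷
  (0̂ ∷ 0̂ ∷ 1̂ ∷ 1̂ ∷ 0̂ ∷ 0̂ ∷ []) ∷
  (0̂ ∷ 1̂ ∷ 1̂ ∷ 0̂ ∷ 0̂ ∷ 1̂ ∷ []) ∷ []

-- Images of length at most 2 give instances of at most 12 letters, which end within two blocks.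
shortInstances : All (λ p → All (λ A → All (λ B → ∀ a b → a ≢ b → ∀ r → r < 12 →
  ¬ Occurs (nth (concatMap block (a ∷ b ∷ []))) r (concatMap (pair A B) p)) (nonEmptyWords 2)) (nonEmptyWords 2)) hardPatterns
shortInstances = toWitness {a? = All.all? (λ p → All.all? (λ A → All.all? (λ B →
  all? λ a → all? λ b → ¬? (a ≟ b) →-dec allBelow? (λ r →
  ¬? (occurs? (nth (concatMap block (a ∷ b ∷ []))) r (concatMap (pair A B) p))) 12) (nonEmptyWords 2)) (nonEmptyWords 2)) hardPatterns} tt

-- Squares in the image of a square-free ternary word

nth-++ˡ : ∀ u {v} j → j < length u → nth (u ++ v) j ≡ nth u j
nth-++ˡ (x ∷ u) zero    _        = refl
nth-++ˡ (x ∷ u) (suc j) (s≤s j<) = nth-++ˡ u j j<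

nth-++ʳ : ∀ u {v} j → nth (u ++ v) (length u + j) ≡ nth v j
nth-++ʳ []      j = refl
nth-++ʳ (x ∷ u) j = nth-++ʳ u j

length-block : ∀ a → length (block a) ≡ 12
length-block 0̂ = refl
length-block 1̂ = refl
length-block 2̂ = refl

segment : (ℕ → Fin 3) → ℕ → ℕ → List (Fin 3)
segment t zero    a = []
segment t (suc n) a = t a ∷ segment t n (suc a)

image : (ℕ → Fin 3) → InfWord 2
image t n = nth (block (t (n / 12))) (n % 12)

image-block : ∀ t a x → x < 12 → image t (a * 12 + x) ≡ nth (block (t a)) x
image-block t a x x<12 = cong₂ (λ b → nth (block (t b)))
  (trans (+-distrib-/-∣ˡ x (n∣m*n a)) (trans (cong₂ _+_ (m*n/n≡m a 12) (m<n⇒m/n≡0 x<12)) (+-identityʳ a)))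
  (trans (%-remove-+ˡ x (n∣m*n a)) (m<n⇒m%n≡m x<12))

image-segment : ∀ t n a j → j < n * 12 → image t (a * 12 + j) ≡ nth (concatMap block (segment t n a)) j
image-segment t (suc n) a j j< with j <? 12
... | yes j<12 = trans (image-block t a j j<12)
  (sym (nth-++ˡ (block (t a)) j (subst (j <_) (sym (length-block (t a))) j<12)))
... | no  j≮12 = begin
  image t (a * 12 + j)                                ≡⟨ cong (λ j → image t (a * 12 + j)) j≡ ⟨
  image t (a * 12 + (12 + (j ∸ 12)))                  ≡⟨ cong (image t) (shift (a * 12) (j ∸ 12)) ⟩
  image t (suc a * 12 + (j ∸ 12))                     ≡⟨ image-segment t n (suc a) (j ∸ 12) (+-cancelˡ-< 12 _ _ (subst (_< suc n * 12) (sym j≡) j<)) ⟩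
  nth (concatMap block (segment t n (suc a))) (j ∸ 12) ≡⟨ nth-++ʳ (block (t a)) (j ∸ 12) ⟨
  nth (concatMap block (segment t (suc n) a)) (length (block (t a)) + (j ∸ 12)) ≡⟨ cong (nth (concatMap block (segment t (suc n) a))) (trans (cong (_+ (j ∸ 12)) (length-block (t a))) j≡) ⟩
  nth (concatMap block (segment t (suc n) a)) j       ∎
  where
  open ≡-Reasoning
  j≡ : 12 + (j ∸ 12) ≡ j
  j≡ = m+[n∸m]≡n (≮⇒≥ j≮12)
  shift : ∀ A k → A + (12 + k) ≡ 12 + A + k
  shift = solve-∀

occurs-segment : ∀ t n a r {u} → r + length u ≤ n * 12 → Occurs (image t) (a * 12 + r) u →
                 Occurs (nth (concatMap block (segment t n a))) r u
occurs-segment t n a r r+u≤ []          = []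
occurs-segment t n a r {x ∷ u} r+u≤ (e ∷ o) =
  trans e (image-segment t n a r (≤-trans (s≤s (m≤m+n r _)) r+u≤′)) ∷
  occurs-segment t n a (suc r) r+u≤′ (subst (λ i → Occurs (image t) i u) (sym (+-suc (a * 12) r)) o)
  where
  r+u≤′ : suc (r + length u) ≤ n * 12
  r+u≤′ = subst (_≤ n * 12) (+-suc r (length u)) r+u≤

module _ {t : ℕ → Fin 3} (squareFree : SquareFree t) where

  noSquare : ∀ M a → 0 < M → ¬ (∀ j → j < M → t (j + a) ≡ t (j + M + a))
  noSquare M a 0<M sq = squareFree M a 0<M λ j j<M →
    trans (cong t (+-comm a j)) (trans (sq j j<M) (cong t (reverse j M a)))
    where
    reverse : ∀ j M a → j + M + a ≡ a + M + j
    reverse = solve-∀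

  adjacent-distinct : ∀ a → t a ≢ t (suc a)
  adjacent-distinct a e = noSquare 1 a z<s λ { zero _ → e ; (suc _) (s≤s ()) }

  noSquare₂ : ∀ a → ¬ (t a ≡ t (2 + a) × t (suc a) ≡ t (3 + a))
  noSquare₂ a (e , e′) = noSquare 2 a z<s λ { 0 _ → e ; 1 _ → e′ ; (suc (suc _)) (s≤s (s≤s ())) }

  module _ (i : ℕ) where
    private
      a = i / 12
      r = i % 12
      r<12 = m%n<n i 12

      i≡ : i ≡ a * 12 + r
      i≡ = trans (m≡m%n+[m/n]*n i 12) (+-comm r (a * 12))

    image-noShortSquare : ∀ m → m < 21 → ¬ Square (image t) (3 + m) i
    image-noShortSquare m m<21 sq = shortSquares
      (t a) (t (1 + a)) (adjacent-distinct a) (t (2 + a)) (adjacent-distinct (1 + a))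
      (t (3 + a)) (adjacent-distinct (2 + a)) (noSquare₂ a)
      (t (4 + a)) (adjacent-distinct (3 + a)) (noSquare₂ (1 + a)) m m<21 r r<12 λ j j<m → begin
      L (r + j)                                ≡⟨ image-segment t 5 a (r + j) (inside₁ j<m) ⟨
      image t (a * 12 + (r + j))               ≡⟨ cong (image t) (trans (sym (+-assoc (a * 12) r j)) (cong (_+ j) (sym i≡))) ⟩
      image t (i + j)                          ≡⟨ sq j j<m ⟩
      image t (i + (3 + m) + j)                ≡⟨ cong (λ i → image t (i + (3 + m) + j)) i≡ ⟩
      image t (a * 12 + r + (3 + m) + j)       ≡⟨ cong (image t) (assoc₄ (a * 12) r (3 + m) j) ⟩
      image t (a * 12 + (r + (3 + m) + j))     ≡⟨ image-segment t 5 a (r + (3 + m) + j) (inside₂ j<m) ⟩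
      L (r + (3 + m) + j)                      ∎
      where
      open ≡-Reasoning
      L = nth (concatMap block (segment t 5 a))

      assoc₄ : ∀ A r m j → A + r + m + j ≡ A + (r + m + j)
      assoc₄ = solve-∀

      inside₂ : ∀ {j} → j < 3 + m → r + (3 + m) + j < 60
      inside₂ j<m = +-mono-≤ (+-mono-≤ r<12 m≤24) (≤-trans (<⇒≤ j<m) m≤24)
        where m≤24 = <⇒≤ (+-monoʳ-< 3 m<21)

      inside₁ : ∀ {j} → j < 3 + m → r + j < 60
      inside₁ {j} j<m = ≤-<-trans (+-monoˡ-≤ j (m≤m+n r (3 + m))) (inside₂ j<m)

    module _ (m : ℕ) (24≤m : 24 ≤ m) (sq : Square (image t) m i) where
      private
        M = m / 12
        ρ = m % 12

        m≡ : m ≡ M * 12 + ρ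
        m≡ = trans (m≡m%n+[m/n]*n m 12) (+-comm ρ (M * 12))

        shifted : ∀ P → i ≤ P → P < i + m → image t P ≡ image t (P + m)
        shifted P i≤P P<i+m = begin
          image t P                    ≡⟨ cong (image t) (m+[n∸m]≡n i≤P) ⟨
          image t (i + (P ∸ i))        ≡⟨ sq (P ∸ i) (+-cancelˡ-< i _ _ (subst (_< i + m) (sym (m+[n∸m]≡n i≤P)) P<i+m)) ⟩
          image t (i + m + (P ∸ i))    ≡⟨ cong (image t) (swap i m (P ∸ i)) ⟩
          image t (i + (P ∸ i) + m)    ≡⟨ cong (λ P → image t (P + m)) (m+[n∸m]≡n i≤P) ⟩
          image t (P + m)              ∎
          where
          open ≡-Reasoning
          swap : ∀ i m x → i + m + x ≡ i + x + m
          swap = solve-∀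

      -- The block at suc a lies in the first half of the square, so it reappears at distance m.
      period-multiple : ρ ≡ 0
      period-multiple with ρ in ρ≡
      ... | zero   = refl
      ... | suc ρ′ = contradiction reappears
        (synchronizing (t (suc a)) (t b) (t (suc b)) ρ′ (s≤s⁻¹ (subst (_< 12) ρ≡ (m%n<n m 12))))
        where
        open ≡-Reasoning
        b = suc a + M

        arrange : ∀ a M ρ j → suc a * 12 + j + (M * 12 + ρ) ≡ (suc a + M) * 12 + (ρ + j)
        arrange = solve-∀

        reappears : Agree (nth (block (t (suc a)))) (λ j → nth (concatMap block (t b ∷ t (suc b) ∷ [])) (suc ρ′ + j)) 12
        reappears j j<12 = begin
          nth (block (t (suc a))) j        ≡⟨ image-block t (suc a) j j<12 ⟨
          image t (suc a * 12 + j)         ≡⟨ shifted (suc a * 12 + j) lower upper ⟩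
          image t (suc a * 12 + j + m)     ≡⟨ cong (image t) (trans (cong (suc a * 12 + j +_) (trans m≡ (cong (M * 12 +_) ρ≡))) (arrange a M (suc ρ′) j)) ⟩
          image t (b * 12 + (suc ρ′ + j))  ≡⟨ image-segment t 2 b (suc ρ′ + j) (+-mono-< (subst (_< 12) ρ≡ (m%n<n m 12)) j<12) ⟩
          nth (concatMap block (t b ∷ t (suc b) ∷ [])) (suc ρ′ + j) ∎
          where
          lower : i ≤ suc a * 12 + j
          lower = ≤-trans (≤-reflexive i≡) (≤-trans (+-monoʳ-≤ (a * 12) (<⇒≤ r<12))
            (≤-trans (≤-reflexive (+-comm (a * 12) 12)) (m≤m+n _ j)))
          -- The block at `suc a` ends at most 24 letters after `i`; here `24 ≤ m` enters.
          upper : suc a * 12 + j < i + m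
          upper = ≤-trans (s≤s (≤-reflexive (comm12 (a * 12) j))) (≤-trans (+-monoʳ-< (a * 12) (+-monoʳ-< 12 j<12))
            (+-mono-≤ (≤-trans (m≤m+n (a * 12) r) (≤-reflexive (sym i≡))) 24≤m))
            where
            comm12 : ∀ A j → 12 + A + j ≡ A + (12 + j)
            comm12 = solve-∀

      private
        m≡M12 : m ≡ M * 12
        m≡M12 = trans m≡ (trans (cong (M * 12 +_) period-multiple) (+-identityʳ _))

        0<M : 0 < M
        0<M with M | m≡M12
        ... | zero  | refl = contradiction 24≤m λ ()
        ... | suc _ | _    = z<s

        i+m≡ : i + m ≡ (a + M) * 12 + r
        i+m≡ = trans (cong₂ _+_ i≡ m≡M12) (arrange a M r)
          where
          arrange : ∀ a M r → a * 12 + r + M * 12 ≡ (a + M) * 12 + r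
          arrange = solve-∀

        letters : ∀ b x → x < 12 → a * 12 + r ≤ b * 12 + x → b * 12 + x < (a + M) * 12 + r →
                  nth (block (t b)) x ≡ nth (block (t (b + M))) x
        letters b x x<12 lower upper = begin
          nth (block (t b)) x              ≡⟨ image-block t b x x<12 ⟨
          image t (b * 12 + x)             ≡⟨ shifted (b * 12 + x) (subst (_≤ b * 12 + x) (sym i≡) lower) (subst (b * 12 + x <_) (sym i+m≡) upper) ⟩
          image t (b * 12 + x + m)         ≡⟨ cong (image t) (trans (cong (b * 12 + x +_) m≡M12) (arrange b M x)) ⟩
          image t ((b + M) * 12 + x)       ≡⟨ image-block t (b + M) x x<12 ⟩
          nth (block (t (b + M))) x        ∎
          where
          open ≡-Reasoning
          arrange : ∀ b M x → b * 12 + x + M * 12 ≡ (b + M) * 12 + x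
          arrange = solve-∀

        -- These blocks lie completely in the first half of the square, so each recurs `M` blocks
        -- later.
        interior : ∀ j → 0 < j → j < M → t (j + a) ≡ t (j + M + a)
        interior j 0<j j<M = block-injective _ _ λ x x<12 →
          subst (λ b → nth (block (t (j + a))) x ≡ nth (block (t b)) x) (arrange j a M)
            (letters (j + a) x x<12
              (≤-trans (+-monoʳ-≤ (a * 12) (<⇒≤ r<12))
              (≤-trans (≤-reflexive (+-comm (a * 12) 12))
              (≤-trans (*-monoˡ-≤ 12 (+-monoˡ-≤ a 0<j)) (m≤m+n _ x))))
              (≤-trans (+-monoʳ-< ((j + a) * 12) x<12)
              (≤-trans (≤-reflexive (+-comm ((j + a) * 12) 12))
              (≤-trans (*-monoˡ-≤ 12 (+-monoˡ-≤ a j<M)) (≤-trans (≤-reflexive (cong (_* 12) (+-comm M a))) (m≤m+n _ r))))))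
          where
          arrange : ∀ j a M → j + a + M ≡ j + M + a
          arrange = solve-∀

        -- The two halves of the square meet at offset `r` in block `a + M`. Its suffix matches that
        -- of block `a`, where the square begins, and its prefix matches that of block `a + M + M`,
        -- where it ends.
        endpoints : t a ≡ t (a + M) ⊎ t (a + M) ≡ t (a + M + M)
        endpoints = cut-determined (t a) (t (a + M)) (t (a + M + M)) r r<12
          (λ j j< → let r+j<12 = subst (r + j <_) (m+[n∸m]≡n (<⇒≤ r<12)) (+-monoʳ-< r j<) in
            letters a (r + j) r+j<12 (+-monoʳ-≤ (a * 12) (m≤m+n r j))
              (≤-trans (+-monoʳ-< (a * 12) r+j<12) (≤-trans (≤-reflexive (+-comm (a * 12) 12)) (after (m≤m+n _ r)))))
          (λ x x<r → letters (a + M) x (<-trans x<r r<12)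
            (≤-trans (+-monoʳ-≤ (a * 12) (<⇒≤ r<12)) (≤-trans (≤-reflexive (+-comm (a * 12) 12)) (after (m≤m+n _ x))))
            (+-monoʳ-< ((a + M) * 12) x<r))
          where
          after : ∀ {n} → (a + M) * 12 ≤ n → suc a * 12 ≤ n
          after = ≤-trans (*-monoˡ-≤ 12 (≤-trans (≤-reflexive (+-comm 1 a)) (+-monoʳ-≤ a 0<M)))

      -- `interior` gives `M - 1` consecutive agreements of `t` at distance `M`. `endpoints` adds
      -- one before or one after them, which completes a square of period `M` at `a` or at `suc a`.
      noLongSquare : ⊥
      noLongSquare = [ first , second ]′ endpoints
        where
        first : t a ≢ t (a + M)
        first e = noSquare M a 0<M λ
          { zero    _   → trans e (cong t (+-comm a M))
          ; (suc j) j<M → interior (suc j) z<s j<M }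

        second : t (a + M) ≢ t (a + M + M)
        second e = noSquare M (suc a) 0<M λ j j<M → step j j<M (m≤n⇒m<n∨m≡n j<M)
          where
          step : ∀ j → j < M → suc j < M ⊎ suc j ≡ M → t (j + suc a) ≡ t (j + M + suc a)
          step j _ (inj₁ j<) = trans (cong t (+-suc j a)) (trans (interior (suc j) z<s j<) (cong t (sym (+-suc (j + M) a))))
          step j _ (inj₂ eq) = trans (cong t (trans (arrange₁ j a) (cong (a +_) eq)))
            (trans e (cong t (trans (cong (λ x → a + x + M) (sym eq)) (arrange₂ j a M))))
            where
            arrange₁ : ∀ j a → j + suc a ≡ a + suc j
            arrange₁ = solve-∀
            arrange₂ : ∀ j a M → a + suc j + M ≡ j + M + suc a
            arrange₂ = solve-∀

  -- Periods 3 to 23 fall to the finite check, and periods from 24 on to synchronization.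
  image-noSquare : ∀ m i → 3 ≤ m → ¬ Square (image t) m i
  image-noSquare (suc (suc (suc m))) i (s≤s (s≤s (s≤s z≤n))) sq with m <? 21
  ... | yes m<21 = image-noShortSquare i m m<21 sq
  ... | no  m≮21 = noLongSquare i (3 + m) (+-monoʳ-≤ 3 (≮⇒≥ m≮21)) sq

-- Renaming of variables and lengths of images

Avoidable : ∀ {k} → ℕ → List (Fin k) → Set
Avoidable n p = ∃ λ (w : InfWord n) → Avoiding w p

avoidable⇒avoidableOver : ∀ {k n} (p : List (Fin k)) → Avoidable n p → AvoidableOver n p
avoidable⇒avoidableOver p (w , av) = w , avoiding⇒avoids p av

-- A morphism `h` on the renamed pattern acts on `p` as `h ∘ v`.
avoiding-map : ∀ {k l n} {w : InfWord n} (v : Fin k → Fin l) p → Avoiding w p → Avoiding w (map v p)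
avoiding-map {w = w} v p av i h ne o = av i (h ∘ v) (ne ∘ v) (subst (Occurs w i) (concatMap-map h v p) o)

length-image : ∀ {k n} {h : Fin k → List (Fin n)} → NonErasing h → ∀ p → length p ≤ length (concatMap h p)
length-image         ne []      = z≤n
length-image {h = h} ne (X ∷ p) = ≤-trans (+-mono-≤ (nonEmpty⇒0<length (h X) (ne X)) (length-image ne p))
                                          (≤-reflexive (sym (length-++ (h X))))

length-image-∈ : ∀ {k n} {h : Fin k → List (Fin n)} {X p} → X ∈ p → length (h X) ≤ length (concatMap h p)
length-image-∈ {h = h} {p = X ∷ p} (here refl) = ≤-trans (m≤m+n _ _) (≤-reflexive (sym (length-++ (h X))))
length-image-∈ {h = h} {p = Y ∷ p} (there X∈) =
  ≤-trans (length-image-∈ X∈) (≤-trans (m≤n+m _ (length (h Y))) (≤-reflexive (sym (length-++ (h Y)))))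

length-image-≤ : ∀ {k n} {h : Fin k → List (Fin n)} {b} → (∀ X → length (h X) ≤ b) →
                 ∀ p → length (concatMap h p) ≤ length p * b
length-image-≤         h≤b []      = z≤n
length-image-≤ {h = h} h≤b (X ∷ p) = ≤-trans (≤-reflexive (length-++ (h X))) (+-mono-≤ (h≤b X) (length-image-≤ h≤b p))

-- Patterns containing squares and overlaps

ternary-avoids : ∀ {k} (a s : List (Fin k)) {b} → 0 < length s → Avoiding ternary (a ++ s ++ s ++ b)
ternary-avoids a s 0<s i h ne o with i′ , sq ← image-square h a s o =
  ternary-squareFree _ i′ (≤-trans 0<s (length-image ne s)) sq

thueMorse₂ : InfWord 2
thueMorse₂ n = encode (thueMorse n)
  module Encode where
  encode : Bool → Fin 2
  encode false = 0̂
  encode true  = 1̂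

  encode-injective : ∀ {a b} → encode a ≡ encode b → a ≡ b
  encode-injective {false} {false} _ = refl
  encode-injective {true}  {true}  _ = refl

-- The period is the length of the image of `X ∷ s`. The letter that turns the square into an
-- overlap is the first one of the third `h X`, which exists as `h` is non-erasing.
thueMorse₂-avoids : ∀ {k} (X : Fin k) s → Avoiding thueMorse₂ (X ∷ s ++ X ∷ s ++ X ∷ [])
thueMorse₂-avoids X s i h ne o = thueMorse-overlapFree m i 0<m
  λ j j≤m → Encode.encode-injective i (overlaps j (m≤n⇒m<n∨m≡n j≤m))
  where
  u = concatMap h (X ∷ s)
  m = length u

  0<m : 0 < m
  0<m = ≤-trans z<s (length-image ne (X ∷ s))

  o₁ : Occurs thueMorse₂ (i + m) (concatMap h (X ∷ s ++ X ∷ []))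
  o₁ = occurs-image-++⁻ʳ h (X ∷ s) o

  overlaps : ∀ j → j < m ⊎ j ≡ m → thueMorse₂ (i + j) ≡ thueMorse₂ (i + m + j)
  overlaps j (inj₁ j<m)  = occurs-agree (occurs-image-++⁻ˡ h (X ∷ s) o) (occurs-image-++⁻ˡ h (X ∷ s) o₁) j j<m
  overlaps j (inj₂ refl) = unshift (occurs-agree (occurs-++⁻ˡ (h X) o₁)
    (occurs-++⁻ˡ (h X) (occurs-image-++⁻ʳ h (X ∷ s) o₁)) 0 (nonEmpty⇒0<length (h X) (ne X)))
    where
    unshift : thueMorse₂ (i + m + 0) ≡ thueMorse₂ (i + m + m + 0) → thueMorse₂ (i + m) ≡ thueMorse₂ (i + m + m)
    unshift rewrite +-identityʳ (i + m) | +-identityʳ (i + m + m) = id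

-- Binary patterns of length six

fewSquares : InfWord 2
fewSquares = image ternary

fewSquares-period : ∀ {k i} {h : Fin k → List (Fin 2)} a s {b} →
  Occurs fewSquares i (concatMap h (a ++ s ++ s ++ b)) → length (concatMap h s) ≤ 2
fewSquares-period {h = h} a s o with i′ , sq ← image-square h a s o =
  s≤s⁻¹ (≰⇒> λ 3≤ → image-noSquare {ternary} ternary-squareFree _ i′ 3≤ sq)

fewSquares-avoids-long : ∀ {k} (a s : List (Fin k)) {b} → 3 ≤ length s → Avoiding fewSquares (a ++ s ++ s ++ b)
fewSquares-avoids-long a s 3≤s i h ne o =
  <⇒≱ (≤-trans 3≤s (length-image ne s)) (fewSquares-period a s o)

-- Such a square bounds the image of `X`: in `fewSquares` the image of `s ++ s` has period at most
-- 2.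
data SquareOver {k} (X : Fin k) : List (Fin k) → Set where
  square : ∀ a s b → X ∈ s → SquareOver X (a ++ s ++ s ++ b)

fewSquares-short : ∀ {k i} {h : Fin k → List (Fin 2)} {X p} → SquareOver X p →
  Occurs fewSquares i (concatMap h p) → length (h X) ≤ 2
fewSquares-short (square a s b X∈s) o = ≤-trans (length-image-∈ X∈s) (fewSquares-period a s o)

-- The two squares force both images to have length at most 2. The instance then lies in the block
-- of `i` and the next one, where `shortInstances` excludes it.
fewSquares-avoids-hard : ∀ {p} → p ∈ hardPatterns → length p ≡ 6 → SquareOver 0̂ p → SquareOver 1̂ p →
  Avoiding fewSquares p
fewSquares-avoids-hard {p} p∈ |p|≡6 sq₀ sq₁ i h ne o =
  All.lookup (All.lookup (All.lookup shortInstances p∈) (∈-nonEmptyWords (h 0̂) (ne 0̂) (h≤2 0̂)))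
    (∈-nonEmptyWords (h 1̂) (ne 1̂) (h≤2 1̂))
    (t a) (t (suc a)) (adjacent-distinct {ternary} ternary-squareFree a) r (m%n<n i 12)
    (subst (Occurs _ r) (concatMap-cong h≡pair p)
      (occurs-segment t 2 a r fits (subst (λ i → Occurs fewSquares i (concatMap h p)) i≡ o)))
  where
  t = ternary
  a = i / 12
  r = i % 12

  i≡ : i ≡ a * 12 + r
  i≡ = trans (m≡m%n+[m/n]*n i 12) (+-comm r (a * 12))

  h≤2 : ∀ X → length (h X) ≤ 2
  h≤2 0̂ = fewSquares-short {i = i} {h} sq₀ o
  h≤2 1̂ = fewSquares-short {i = i} {h} sq₁ o

  h≡pair : ∀ X → h X ≡ pair (h 0̂) (h 1̂) X
  h≡pair 0̂ = refl
  h≡pair 1̂ = refl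

  fits : r + length (concatMap h p) ≤ 24
  fits = +-mono-≤ (<⇒≤ (m%n<n i 12)) (≤-trans (length-image-≤ h≤2 p) (≤-reflexive (cong (_* 2) |p|≡6)))

-- Each word of six letters over `A` and `B` that starts with `A` contains an overlap, avoided by
-- Thue-Morse, or is the square of a word of length 3 or one of `hardPatterns`, both avoided by
-- `fewSquares`.
avoidable-six : ∀ b c d e f (rest : List (Fin 2)) → Avoidable 2 (0̂ ∷ b ∷ c ∷ d ∷ e ∷ f ∷ rest)
avoidable-six = go
  where
  A B : Fin 2
  A = 0̂
  B = 1̂

  overlap-at : ∀ (a : List (Fin 2)) X s rest → Avoidable 2 (a ++ (X ∷ s ++ X ∷ s ++ X ∷ []) ++ rest)
  overlap-at a X s rest = thueMorse₂ , avoiding-factor a (X ∷ s ++ X ∷ s ++ X ∷ []) {rest} (thueMorse₂-avoids X s)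

  long-square : ∀ (s : List (Fin 2)) rest → 3 ≤ length s → Avoidable 2 (s ++ s ++ rest)
  long-square s rest 3≤s = fewSquares , fewSquares-avoids-long [] s {rest} 3≤s

  hard : ∀ {p} rest → p ∈ hardPatterns → length p ≡ 6 → SquareOver A p → SquareOver B p → Avoidable 2 (p ++ rest)
  hard {p} rest p∈ |p|≡6 sq₀ sq₁ =
    fewSquares , avoiding-factor [] p {rest} (fewSquares-avoids-hard p∈ |p|≡6 sq₀ sq₁)

  pattern 1st = here refl
  pattern 2nd = there (here refl)

  go : ∀ b c d e f (rest : List (Fin 2)) → Avoidable 2 (0̂ ∷ b ∷ c ∷ d ∷ e ∷ f ∷ rest)
  go 0̂ 0̂ d e f rest = overlap-at [] A [] (d ∷ e ∷ f ∷ rest)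
  go 0̂ 1̂ 0̂ 0̂ 0̂ rest = overlap-at (A ∷ A ∷ B ∷ []) A [] rest
  go 0̂ 1̂ 0̂ 0̂ 1̂ rest = long-square (A ∷ A ∷ B ∷ []) rest ≤-refl
  go 0̂ 1̂ 0̂ 1̂ 0̂ rest = overlap-at (A ∷ []) A (B ∷ []) rest
  go 0̂ 1̂ 0̂ 1̂ 1̂ rest = hard rest (there 2nd) refl
    (square (A ∷ []) (A ∷ B ∷ []) (B ∷ []) 1st) (square (A ∷ []) (A ∷ B ∷ []) (B ∷ []) 2nd)
  go 0̂ 1̂ 1̂ 0̂ 0̂ rest = hard rest (there (there (there (there 2nd)))) refl
    (square [] (A ∷ []) (B ∷ B ∷ A ∷ A ∷ []) 1st) (square (A ∷ A ∷ []) (B ∷ []) (A ∷ A ∷ []) 1st)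
  go 0̂ 1̂ 1̂ 0̂ 1̂ rest = hard rest (there (there 2nd)) refl
    (square [] (A ∷ []) (B ∷ B ∷ A ∷ B ∷ []) 1st) (square (A ∷ A ∷ []) (B ∷ []) (A ∷ B ∷ []) 1st)
  go 0̂ 1̂ 1̂ 1̂ f rest = overlap-at (A ∷ A ∷ []) B [] (f ∷ rest)
  go 1̂ 0̂ 0̂ 0̂ f rest = overlap-at (A ∷ B ∷ []) A [] (f ∷ rest)
  go 1̂ 0̂ 0̂ 1̂ 0̂ rest = long-square (A ∷ B ∷ A ∷ []) rest ≤-refl
  go 1̂ 0̂ 0̂ 1̂ 1̂ rest = hard rest (there (there (there 2nd))) refl
    (square (A ∷ B ∷ []) (A ∷ []) (B ∷ B ∷ []) 1st) (square (A ∷ B ∷ A ∷ A ∷ []) (B ∷ []) [] 1st)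
  go 1̂ 0̂ 1̂ 0̂ f rest = overlap-at [] A (B ∷ []) (f ∷ rest)
  go 1̂ 0̂ 1̂ 1̂ 0̂ rest = hard rest 1st refl
    (square [] (A ∷ B ∷ []) (B ∷ A ∷ []) 1st) (square [] (A ∷ B ∷ []) (B ∷ A ∷ []) 2nd)
  go 1̂ 0̂ 1̂ 1̂ 1̂ rest = overlap-at (A ∷ B ∷ A ∷ []) B [] rest
  go 1̂ 1̂ 0̂ 0̂ 0̂ rest = overlap-at (A ∷ B ∷ B ∷ []) A [] rest
  go 1̂ 1̂ 0̂ 0̂ 1̂ rest = hard rest (there (there (there (there (there 2nd))))) refl
    (square (A ∷ B ∷ B ∷ []) (A ∷ []) (B ∷ []) 1st) (square (A ∷ []) (B ∷ []) (A ∷ A ∷ B ∷ []) 1st)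
  go 1̂ 1̂ 0̂ 1̂ 0̂ rest = hard rest 2nd refl
    (square (A ∷ B ∷ []) (B ∷ A ∷ []) [] 2nd) (square (A ∷ B ∷ []) (B ∷ A ∷ []) [] 1st)
  go 1̂ 1̂ 0̂ 1̂ 1̂ rest = long-square (A ∷ B ∷ B ∷ []) rest ≤-refl
  go 1̂ 1̂ 1̂ e f rest = overlap-at (A ∷ []) B [] (e ∷ f ∷ rest)

-- Removing a variable that occurs at most once

module _ {k} (X : Fin (suc k)) where

  unpunch : ∀ p → count X p ≤ 0 → ∃ λ q → p ≡ map (punchIn X) q
  unpunch []      _ = [] , refl
  unpunch (Y ∷ p) c with X ≟ Y
  ... | no X≢Y with q , refl ← unpunch p c = punchOut X≢Y ∷ q , cong (_∷ _) (sym (punchIn-punchOut X≢Y))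

  splitAtSingle : ∀ p → count X p ≤ 1 → (∃ λ q → p ≡ map (punchIn X) q) ⊎
    (∃₂ λ q₁ q₂ → p ≡ map (punchIn X) q₁ ++ X ∷ map (punchIn X) q₂)
  splitAtSingle []      _ = inj₁ ([] , refl)
  splitAtSingle (Y ∷ p) c with X ≟ Y
  ... | yes refl with q₂ , refl ← unpunch p (s≤s⁻¹ c) = inj₂ ([] , q₂ , refl)
  ... | no  X≢Y with splitAtSingle p c
  ...   | inj₁ (q , refl)       = inj₁ (punchOut X≢Y ∷ q , cong (_∷ _) (sym (punchIn-punchOut X≢Y)))
  ...   | inj₂ (q₁ , q₂ , refl) = inj₂ (punchOut X≢Y ∷ q₁ , q₂ , cong (_∷ _) (sym (punchIn-punchOut X≢Y)))

  -- If `X` occurs, the two sides of its occurrence have together at least `2N - 1` letters, so one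
  -- of them has at least `N`; a word avoiding that side avoids `p`.
  removeVariable : ∀ {n} p N → count X p ≤ 1 → N + N ≤ length p →
    (∀ (q : List (Fin k)) → N ≤ length q → Avoidable n q) → Avoidable n p
  removeVariable p N c 2N≤p avoidable with splitAtSingle p c
  ... | inj₁ (q , refl)
    with w , av ← avoidable q (≤-trans (m≤m+n N N) (subst (N + N ≤_) (length-map (punchIn X) q) 2N≤p))
    = w , avoiding-map (punchIn X) q av
  ... | inj₂ (q₁ , q₂ , refl) with N ≤? length q₁
  ...   | yes N≤q₁ with w , av ← avoidable q₁ N≤q₁ =
    w , avoiding-factor [] (map (punchIn X) q₁) (avoiding-map (punchIn X) q₁ av)
  ...   | no  N≰q₁ = let w , av = avoidable q₂ N≤q₂ in w , λ i h ne o →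
    avoiding-map (punchIn X) q₂ av _ h ne
      (occurs-image-++⁻ʳ h (X ∷ []) {map (punchIn X) q₂} (occurs-image-++⁻ʳ h (map (punchIn X) q₁) o))
    where
    lengths : length (map (punchIn X) q₁ ++ X ∷ map (punchIn X) q₂) ≡ length q₁ + suc (length q₂)
    lengths = trans (length-++ (map (punchIn X) q₁))
      (cong₂ (λ a b → a + suc b) (length-map (punchIn X) q₁) (length-map (punchIn X) q₂))

    N≤q₂ : N ≤ length q₂
    -- The removed letter is counted with the short side: `suc (length q₁) ≤ N`.
    N≤q₂ = +-cancelˡ-≤ N _ _ (≤-trans 2N≤p (≤-trans
      (≤-reflexive (trans lengths (+-suc (length q₁) (length q₂)))) (+-monoˡ-≤ (length q₂) (≰⇒> N≰q₁))))

-- Numerical parameters for three and two letters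

-- The excess `a = 2` is `2^3 - 2 * 3`. With `S = 1/5` the condition `growth` is an equality, and
-- `s` lies just above the exact geometric sum `63/62`.
ternaryBudget : Budget 3 3 2
ternaryBudget = record
  { c = ℤ.+ 2 ℚ./ 5 ; q = ℤ.+ 21 ℚ./ 20 ; s = ℤ.+ 51 ℚ./ 50 ; S = ℤ.+ 1 ℚ./ 5 ; K = 20
  ; 0≤c = toWitness {a? = _ ℚₚ.≤? _} tt
  ; c≤1 = toWitness {a? = _ ℚₚ.≤? _} tt
  ; 1≤q = toWitness {a? = _ ℚₚ.≤? _} tt
  ; 0≤s = toWitness {a? = _ ℚₚ.≤? _} tt
  ; S<1 = toWitness {a? = _ ℚₚ.<? _} tt
  ; delay = toWitness {a? = _ ℚₚ.≤? _} tt
  ; geometric = toWitness {a? = _ ℚₚ.≤? _} tt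
  ; cs≤1 = toWitness {a? = _ ℚₚ.≤? _} tt
  ; base = toWitness {a? = _ ℚₚ.≤? _} tt
  ; growth = toWitness {a? = _ ℚₚ.≤? _} tt
  }

-- Here the excess is `12 - 2 * 3 = 6`. Again `growth` is an equality; `K = 32` is the least
-- exponent with `(51/50)^K ≥ 15/8`.
binaryBudget : Budget 2 3 6
binaryBudget = record
  { c = ℤ.+ 8 ℚ./ 15 ; q = ℤ.+ 51 ℚ./ 50 ; s = ℤ.+ 139 ℚ./ 100 ; S = ℤ.+ 1 ℚ./ 15 ; K = 32
  ; 0≤c = toWitness {a? = _ ℚₚ.≤? _} tt
  ; c≤1 = toWitness {a? = _ ℚₚ.≤? _} tt
  ; 1≤q = toWitness {a? = _ ℚₚ.≤? _} tt
  ; 0≤s = toWitness {a? = _ ℚₚ.≤? _} tt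
  ; S<1 = toWitness {a? = _ ℚₚ.<? _} tt
  ; delay = toWitness {a? = _ ℚₚ.≤? _} tt
  ; geometric = toWitness {a? = _ ℚₚ.≤? _} tt
  ; cs≤1 = toWitness {a? = _ ℚₚ.≤? _} tt
  ; base = toWitness {a? = _ ℚₚ.≤? _} tt
  ; growth = toWitness {a? = _ ℚₚ.≤? _} tt
  }

-- Long patterns

swap : Fin 2 → Fin 2
swap 0̂ = 1̂
swap 1̂ = 0̂

swap-involutive : ∀ X → swap (swap X) ≡ X
swap-involutive 0̂ = refl
swap-involutive 1̂ = refl

avoidable-swap : ∀ {n} p → Avoidable n (map swap p) → Avoidable n p
avoidable-swap p (w , av) = w , subst (Avoiding w)
  (trans (sym (map-∘ p)) (trans (map-cong swap-involutive p) (map-id p))) (avoiding-map swap (map swap p) av)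

square-avoidable : ∀ {k} (a s b : List (Fin k)) → 0 < length s → Avoidable 3 (a ++ s ++ s ++ b)
square-avoidable a s b 0<s = ternary , ternary-avoids a s {b} 0<s

-- For `k = 3 + j` this reads `3k - 1 ≤ 2^k`, with equality at `k = 3`. A further variable adds 3 on
-- the left and doubles the right.
ternary-length : ∀ j → (3 + j) * 2 + (2 + j) ≤ 2 ^ (3 + j)
ternary-length zero    = ≤-refl
ternary-length (suc j) = begin
  (4 + j) * 2 + (3 + j)           ≡⟨ arrange j ⟩
  3 + ((3 + j) * 2 + (2 + j))     ≤⟨ +-mono-≤ (≤-trans (m≤m+n 3 _) (ternary-length j)) (ternary-length j) ⟩
  2 ^ (3 + j) + 2 ^ (3 + j)       ≡⟨ cong (λ x → 2 ^ (3 + j) + x) (+-identityʳ (2 ^ (3 + j))) ⟨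
  2 ^ (4 + j)                     ∎
  where
  open ≤-Reasoning
  arrange : ∀ j → (4 + j) * 2 + (3 + j) ≡ 3 + ((3 + j) * 2 + (2 + j))
  arrange = solve-∀

3x+3x≡3[2x] : ∀ x → 3 * x + 3 * x ≡ 3 * (2 * x)
3x+3x≡3[2x] = solve-∀

-- Likewise `3k + 3 ≤ 3 * 2^(k - 1)`, with equality at `k = 3`.
binary-length : ∀ j → (3 + j) * 2 + (6 + j) ≤ 3 * 2 ^ (2 + j)
binary-length zero    = ≤-refl
binary-length (suc j) = begin
  (4 + j) * 2 + (7 + j)                   ≡⟨ arrange j ⟩
  3 + ((3 + j) * 2 + (6 + j))             ≤⟨ +-mono-≤ (≤-trans (m≤m+n 3 _) (binary-length j)) (binary-length j) ⟩
  3 * 2 ^ (2 + j) + 3 * 2 ^ (2 + j)       ≡⟨ 3x+3x≡3[2x] (2 ^ (2 + j)) ⟩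
  3 * 2 ^ (3 + j)                         ∎
  where
  open ≤-Reasoning
  arrange : ∀ j → (4 + j) * 2 + (7 + j) ≡ 3 + ((3 + j) * 2 + (6 + j))
  arrange = solve-∀

-- `N` is the length bound for one variable fewer. A rare variable is removed; without one, the
-- weighted greedy argument applies.
inductionStep : ∀ {m a N} → Budget m 3 a → ∀ j (p : List (Fin (3 + j))) →
  N + N ≤ length p → (3 + j) * 2 + (a + j) ≤ length p →
  (∀ (q : List (Fin (2 + j))) → N ≤ length q → Avoidable m q) → Avoidable m p
inductionStep {N = N} budget j p 2N≤p long avoidable with any? (λ X → count X p ≤? 1)
... | yes (X , single) = removeVariable X p N single 2N≤p avoidable
... | no  none         = avoidable-doubled budget j p (λ X → ≰⇒> λ le → none (X , le)) long

-- The claim covers all words over `Fin k`, so that the induction applies to factors that miss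
-- further variables. For two variables, any four letters contain a square.
ternary-avoidable : ∀ k (p : List (Fin k)) → 2 ^ k ≤ length p → Avoidable 3 p
ternary-avoidable 0 [] ()
ternary-avoidable 1 (_ ∷ []) (s≤s ())
ternary-avoidable 1 (0̂ ∷ 0̂ ∷ p) _ = square-avoidable [] (0̂ ∷ []) p z<s
ternary-avoidable 2 (_ ∷ []) (s≤s ())
ternary-avoidable 2 (_ ∷ _ ∷ []) (s≤s (s≤s ()))
ternary-avoidable 2 (_ ∷ _ ∷ _ ∷ []) (s≤s (s≤s (s≤s ())))
ternary-avoidable 2 (0̂ ∷ 0̂ ∷ x ∷ y ∷ p) _ = square-avoidable [] (0̂ ∷ []) (x ∷ y ∷ p) z<s
ternary-avoidable 2 (1̂ ∷ 1̂ ∷ x ∷ y ∷ p) _ = square-avoidable [] (1̂ ∷ []) (x ∷ y ∷ p) z<s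
ternary-avoidable 2 (0̂ ∷ 1̂ ∷ 1̂ ∷ y ∷ p) _ = square-avoidable (0̂ ∷ []) (1̂ ∷ []) (y ∷ p) z<s
ternary-avoidable 2 (1̂ ∷ 0̂ ∷ 0̂ ∷ y ∷ p) _ = square-avoidable (1̂ ∷ []) (0̂ ∷ []) (y ∷ p) z<s
ternary-avoidable 2 (0̂ ∷ 1̂ ∷ 0̂ ∷ 0̂ ∷ p) _ = square-avoidable (0̂ ∷ 1̂ ∷ []) (0̂ ∷ []) p z<s
ternary-avoidable 2 (1̂ ∷ 0̂ ∷ 1̂ ∷ 1̂ ∷ p) _ = square-avoidable (1̂ ∷ 0̂ ∷ []) (1̂ ∷ []) p z<s
ternary-avoidable 2 (0̂ ∷ 1̂ ∷ 0̂ ∷ 1̂ ∷ p) _ = square-avoidable [] (0̂ ∷ 1̂ ∷ []) p z<s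
ternary-avoidable 2 (1̂ ∷ 0̂ ∷ 1̂ ∷ 0̂ ∷ p) _ = square-avoidable [] (1̂ ∷ 0̂ ∷ []) p z<s
ternary-avoidable (suc (suc (suc j))) p long = inductionStep ternaryBudget j p
  (≤-trans (≤-reflexive (cong (λ x → 2 ^ (2 + j) + x) (sym (+-identityʳ (2 ^ (2 + j)))))) long)
  (≤-trans (ternary-length j) long) (ternary-avoidable (suc (suc j)))

-- For one variable, three letters form an overlap. For two, exchanging the variables makes `0̂` the
-- first letter.
binary-avoidable : ∀ k (p : List (Fin k)) → 3 * 2 ^ (k ∸ 1) ≤ length p → Avoidable 2 p
binary-avoidable 0 [] ()
binary-avoidable 1 (_ ∷ []) (s≤s ())
binary-avoidable 1 (_ ∷ _ ∷ []) (s≤s (s≤s ()))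
binary-avoidable 1 (0̂ ∷ 0̂ ∷ 0̂ ∷ p) _ =
  thueMorse₂ , avoiding-factor [] (0̂ ∷ 0̂ ∷ 0̂ ∷ []) {p} (thueMorse₂-avoids 0̂ [])
binary-avoidable 2 (_ ∷ []) (s≤s ())
binary-avoidable 2 (_ ∷ _ ∷ []) (s≤s (s≤s ()))
binary-avoidable 2 (_ ∷ _ ∷ _ ∷ []) (s≤s (s≤s (s≤s ())))
binary-avoidable 2 (_ ∷ _ ∷ _ ∷ _ ∷ []) (s≤s (s≤s (s≤s (s≤s ()))))
binary-avoidable 2 (_ ∷ _ ∷ _ ∷ _ ∷ _ ∷ []) (s≤s (s≤s (s≤s (s≤s (s≤s ())))))
binary-avoidable 2 (0̂ ∷ b ∷ c ∷ d ∷ e ∷ f ∷ p) _ = avoidable-six b c d e f p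
binary-avoidable 2 (1̂ ∷ b ∷ c ∷ d ∷ e ∷ f ∷ p) _ = avoidable-swap (1̂ ∷ b ∷ c ∷ d ∷ e ∷ f ∷ p)
  (avoidable-six (swap b) (swap c) (swap d) (swap e) (swap f) (map swap p))
binary-avoidable (suc (suc (suc j))) p long = inductionStep binaryBudget j p
  (≤-trans (≤-reflexive (3x+3x≡3[2x] (2 ^ (1 + j)))) long)
  (≤-trans (binary-length j) long) (binary-avoidable (suc (suc j)))

-- Alphabets with fewer than two letters

-- Over a single letter, sending every variable to that letter gives an instance of `p` that is a
-- prefix of the infinite word.
unavoidable-below-2 : ∀ {k} (p : List (Fin k)) n → n < 2 → ¬ AvoidableOver n p
unavoidable-below-2 p zero _ (w , _) with () ← w 0
unavoidable-below-2 p (suc zero) _ (w , avoids) =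
  avoids u (0 , unary u _ (sym (length-applyUpTo w (length u)))) ((λ _ → 0̂ ∷ []) , (λ _ ()) , refl)
  where
  u : List (Fin 1)
  u = concatMap (λ _ → 0̂ ∷ []) p

  unary : ∀ (u v : List (Fin 1)) → length u ≡ length v → u ≡ v
  unary []      []      _ = refl
  unary (0̂ ∷ u) (0̂ ∷ v) e = cong (0̂ ∷_) (unary u v (suc-injective e))
unavoidable-below-2 p (suc (suc _)) (s≤s (s≤s ()))

theorem2 : (k : ℕ) → 1 ≤ k → (p : List (Fin k)) → NonEmpty p → UsesAllVars p →
    ((2 ^ k ≤ length p → AvoidIndexLE p 3) ×
    (3 * 2 ^ (k ∸ 1) ≤ length p → AvoidIndexEq p 2))
theorem2 k _ p _ _ =
  (λ long → 3 , ≤-refl , avoidable⇒avoidableOver p (ternary-avoidable k p long)) ,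
  (λ long → avoidable⇒avoidableOver p (binary-avoidable k p long) , unavoidable-below-2 p)
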